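{- Cluster Vertex Deletion parameterized by solution size $k$ is $(\mathrm{VA}, n/p, p)$-hard for every $p\in\mathbb{N}$, even when restricted to input graphs $G$ with maximum degree $\Delta(G)=O(1)$.
   Context: All graphs are finite, simple and undirected; $n$ is the number of vertices of the input graph $G$, and the vertex set is known in advance. $\Delta(G)$ denotes the maximum degree of $G$; "restricted to graphs with $\Delta(G)=O(1)$" means that the hardness holds already for inputs whose maximum degree is at most some absolute constant. Cluster Vertex Deletion: the input is a graph $G$ (presented as a stream) and a non-negative integer $k$; the question is whether there is a set $X\subset V(G)$ of size at most $k$ such that $G\setminus X$ (the subgraph induced by $V(G)\setminus X$) is a cluster graph, i.e. a disjoint union of cliques, equivalently contains no induced path $P_3$ on three vertices. VA (vertex arrival) model: the vertices are exposed one after another in an arbitrary order; when a vertex $v$ is exposed, all edges between $v$ and its already exposed neighbors are revealed one by one in an arbitrary order. A $p$-pass streaming algorithm may read the stream $p$ times in the same order. It solves a problem in a streaming model if it is a (possibly randomized) algorithm which, on every input instance presented in that model, gives the correct output with probability at least $2/3$. For a streaming model $\mathcal{M}$ and a function $f$ of $n$ and the parameter, a problem is $(\mathcal{M},f,p)$-hard if no $p$-pass streaming algorithm using $o(f)$ bits of space solves it in model $\mathcal{M}$. -}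

module Defs where

open import Data.Bool.Base using (Bool; true; false; not)
open import Data.Fin.Base using (Fin)
open import Data.Fin.Subset using (Subset; ∣_∣; _∉_)
open import Data.Integer.Base using (+_)
open import Data.List.Base using (List; []; _∷_; _++_; map; foldl; filterᵇ; allFin)
open import Data.List.Extrema.Nat using (max)
open import Data.List.Relation.Binary.Permutation.Propositional using (_↭_)
open import Data.Nat.Base as ℕ using (ℕ; suc; NonZero)
open import Data.Product.Base using (Σ-syntax; ∃-syntax; _×_; proj₁)
open import Data.Rational.Unnormalised.Base using (ℚᵘ; 0ℚᵘ; _/_; _≤_; _<_; _*_)
open import Data.Vec.Base using (Vec; tabulate)
open import Function.Bundles using (_⇔_)
open import Relation.Binary.PropositionalEquality.Core using (_≡_; _≢_)
open import Relation.Nullary.Negation.Core using (¬_)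

record Graph (V : Set) : Set where
  field
    adj         : V → V → Bool
    symmetric   : ∀ u v → adj u v ≡ adj v u
    irreflexive : ∀ v → adj v v ≡ false

open Graph public

degree : ∀ {n} → Graph (Fin n) → Fin n → ℕ
degree G v = ∣ tabulate (adj G v) ∣

Δ : ∀ {n} → Graph (Fin n) → ℕ
Δ {n} G = max 0 (map (degree G) (allFin n))

-- Proofs of v ∉ X are definitionally equal (negations are irrelevant in the
-- standard library), so the vertices of G ∖ X are exactly those outside X,
-- without duplicates.
_∖_ : ∀ {n} → Graph (Fin n) → (X : Subset n) → Graph (Σ[ v ∈ Fin n ] v ∉ X)
G ∖ X = record
  { adj         = λ u v → adj G (proj₁ u) (proj₁ v)
  ; symmetric   = λ u v → symmetric G (proj₁ u) (proj₁ v)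
  ; irreflexive = λ v → irreflexive G (proj₁ v)
  }

-- A disjoint union of cliques: the vertices can be labelled by cliques so that
-- there are all edges inside each clique and none between different cliques.
IsCluster : {V : Set} → Graph V → Set
IsCluster {V} G =
  Σ[ clique ∈ (V → ℕ) ] (∀ u v → u ≢ v → adj G u v ≡ true ⇔ clique u ≡ clique v)

ClusterVertexDeletion : ∀ {n} → Graph (Fin n) → ℕ → Set
ClusterVertexDeletion {n} G k = Σ[ X ∈ Subset n ] (∣ X ∣ ℕ.≤ k × IsCluster (G ∖ X))

record StreamModel : Set₁ where
  field
    Token    : ℕ → Set
    Presents : ∀ {n} → List (Token n) → Graph (Fin n) → Set

data VAToken (n : ℕ) : Set where
  vertex : Fin n → VAToken n
  edge   : Fin n → Fin n → VAToken n

-- Streams for the rest of the input once the vertices in `seen` are exposed.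
-- The final condition makes the vertices exposed overall an enumeration of the
-- vertex set, so `seen` never contains repetitions.
data VAFrom {n} (G : Graph (Fin n)) (seen : List (Fin n)) : List (VAToken n) → Set where
  done   : seen ↭ allFin n → VAFrom G seen []
  arrive : ∀ v {nbrs rest} →
           nbrs ↭ filterᵇ (adj G v) seen →
           VAFrom G (v ∷ seen) rest →
           VAFrom G seen (vertex v ∷ map (edge v) nbrs ++ rest)

VA : StreamModel
VA = record { Token = VAToken ; Presents = λ σ G → VAFrom G [] σ }

-- A randomized p-pass algorithm with s bits of memory: a deterministic one
-- chosen by a uniformly random seed. Only the memory contents persist between
-- tokens. The update may depend on the seed, on the pass and on the number of
-- tokens already read in it; hence the seed can supply both a shared random
-- string and fresh coins for every step.
record Algorithm (Token : Set) (p s : ℕ) : Set where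
  field
    seeds       : ℕ
    {{nonZero}} : NonZero seeds
    start       : Fin seeds → Vec Bool s
    step        : Fin seeds → Fin p → ℕ → Token → Vec Bool s → Vec Bool s
    accept      : Fin seeds → Vec Bool s → Bool

  pass : Fin seeds → Fin p → ℕ → List Token → Vec Bool s → Vec Bool s
  pass ω i t []      m = m
  pass ω i t (x ∷ σ) m = pass ω i (suc t) σ (step ω i t x m)

  output : List Token → Fin seeds → Bool
  output σ ω = accept ω (foldl (λ m i → pass ω i 0 σ m) (start ω) (allFin p))

Pr : ∀ {r} {{_ : NonZero r}} → (Fin r → Bool) → ℚᵘ
Pr {r} E = + ∣ tabulate E ∣ / r

SolvesInstance : ∀ {Token p s} → Algorithm Token p s → List Token → Set → Set
SolvesInstance A σ Yes =
  (Yes → + 2 / 3 ≤ Pr (output σ)) × (¬ Yes → + 2 / 3 ≤ Pr (λ ω → not (output σ ω)))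
  where open Algorithm A

-- s = o(f) as n → ∞, uniformly in the parameter k.
_∈o_ : (ℕ → ℕ → ℕ) → (ℕ → ℕ → ℚᵘ) → Set
s ∈o f = ∀ ε → 0ℚᵘ < ε → ∃[ N ] ∀ n k → N ℕ.≤ n → + s n k / 1 ≤ ε * f n k

-- (M , f , p)-hardness of the parameterized problem P restricted to the graphs
-- in C. The number of vertices and the parameter are known to the algorithm,
-- which may be chosen separately for each of their values.
Hard : StreamModel → (ℕ → ℕ → ℚᵘ) → ℕ →
       (C : ∀ {n} → Graph (Fin n) → Set) →
       (P : ∀ {n} → Graph (Fin n) → ℕ → Set) → Set
Hard M f p C P =
  ¬ (Σ[ s ∈ (ℕ → ℕ → ℕ) ] s ∈o f ×
     Σ[ A ∈ (∀ n k → Algorithm (Token n) p (s n k)) ]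
       (∀ n k (G : Graph (Fin n)) → C G → ∀ σ → Presents σ G →
        SolvesInstance (A n k) σ (P G k)))
  where open StreamModel M

{-# OPTIONS --safe #-}

-- The inner product modulo 2 of x (known to Alice) and y (known to Bob) in {0,1}^m
-- is encoded by four strands, named by pairs of bits (h , l), which run through
-- layers joined by perfect matchings.  In period j Alice's matching brings l to
-- l ⊕ xⱼ, and Bob's matching then flips h iff yⱼ = 1 and the second bit is 1.  The
-- strand (0 , 0) therefore ends at (x · y , 0).  Extending this strand at its start
-- and cutting off one strand at the end makes the strands into paths whose lengths
-- modulo 3 are such that destroying all induced P₃ takes 4m + 1 deletions if
-- x · y = 0 and 4m deletions if x · y = 1.
--
-- Alice's vertices arrive before Bob's, so a p-pass algorithm with s bits of memory
-- is a protocol of 2p messages of s bits.  It cuts the matrix (-1)^(x · y) into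
-- 4^(sp) rectangles.  By Cauchy–Schwarz and Parseval each of them has discrepancy at
-- most 8^r, where m = 2r.  Averaging the success probability over all x , y gives
-- 16^r ≤ 3 · 4^(sp) · 8^r, so that r < 2sp + 2.
module Submission where

open import Defs
open import Data.Bool.Base using (Bool; true; false; not; T; _∧_; _∨_; _xor_; if_then_else_)
import Data.Bool.Properties as Bool
open import Data.Bool.Properties using (T?; xor-assoc; xor-same; xor-identityʳ; ∨-comm)
open import Data.Empty using (⊥)
open import Data.Fin.Base as Fin using (Fin; zero; suc; toℕ; combine; remQuot; _↑ˡ_; _↑ʳ_; inject₁)
import Data.Fin.Properties as Fin
open import Data.Fin.Subset using (Subset; _∉_) renaming (∣_∣ to ∥_∥)
open import Data.Integer.Base as ℤ using (ℤ; +_; -_; ∣_∣; 0ℤ; 1ℤ; -1ℤ)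
import Data.Integer.Properties as ℤ
import Data.Integer.Tactic.RingSolver as ℤ
open import Data.List.Base as List using (List; []; _∷_; _++_; length; foldl; filterᵇ; allFin)
open import Data.List.Extrema.Nat using (max≤v⁺)
import Data.List.Properties as List
open import Data.List.Relation.Binary.Permutation.Propositional using (_↭_; prep; ↭-refl; ↭-sym; ↭-trans; ↭-reflexive)
import Data.List.Relation.Binary.Permutation.Propositional.Properties as ↭
open import Data.List.Relation.Unary.All as All using (All; []; _∷_)
import Data.List.Relation.Unary.All.Properties as All
open import Data.Nat.Base as ℕ using (ℕ; zero; suc; NonZero; _+_; _*_; _^_; _≤_; _<_; _≡ᵇ_; z≤n; s≤s)
import Data.Nat.Properties as ℕ
import Data.Nat.Tactic.RingSolver as ℕ
open import Data.Product.Base using (Σ; ∃-syntax; _×_; _,_; proj₁; proj₂)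
open import Data.Product.Properties using (≡-dec)
open import Data.Rational.Unnormalised.Base using (_/_; *≤*; *<*) renaming (_≤_ to _≤ℚ_; _*_ to _*ℚ_)
open import Data.Sum.Base as Sum using (_⊎_; inj₁; inj₂)
open import Data.Vec.Base as Vec using (Vec; []; _∷_; tabulate; lookup; allPairs)
import Data.Vec.Properties as Vec
open import Function.Base using (_∘_; id; const)
open import Function.Bundles using (_⇔_; mk⇔; Equivalence)
open import Relation.Binary.Definitions using (DecidableEquality)
open import Relation.Binary.PropositionalEquality
open import Relation.Nullary.Decidable using (Dec; yes; no; does; _×-dec_; _→-dec_; ¬?; from-yes; dec-true)
open import Relation.Nullary.Negation.Core using (¬_; contradiction)

open import Algebra.Properties.CommutativeMonoid.Sum ℕ.+-0-commutativeMonoid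
  using (sum; sum-cong-≗)
open import Algebra.Properties.CommutativeMonoid.Sum ℤ.+-0-commutativeMonoid
  using () renaming (sum to sumℤ; ∑-distrib-+ to sumℤ-+; sum-cong-≗ to sumℤ-cong)

-- The discrepancy of the inner product

∑ : ∀ {m} → (Vec Bool m → ℤ) → ℤ
∑ {zero}  f = f []
∑ {suc m} f = ∑ (f ∘ (false ∷_)) ℤ.+ ∑ (f ∘ (true ∷_))

∑-cong : ∀ {m} {f g : Vec Bool m → ℤ} → (∀ x → f x ≡ g x) → ∑ f ≡ ∑ g
∑-cong {zero}  f≗g = f≗g []
∑-cong {suc m} f≗g = cong₂ ℤ._+_ (∑-cong (f≗g ∘ (false ∷_))) (∑-cong (f≗g ∘ (true ∷_)))

+-interchange : ∀ a b c d → (a ℤ.+ b) ℤ.+ (c ℤ.+ d) ≡ (a ℤ.+ c) ℤ.+ (b ℤ.+ d)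
+-interchange = ℤ.solve-∀

∑-+ : ∀ {m} (f g : Vec Bool m → ℤ) → ∑ (λ x → f x ℤ.+ g x) ≡ ∑ f ℤ.+ ∑ g
∑-+ {zero}  f g = refl
∑-+ {suc m} f g = trans
  (cong₂ ℤ._+_ (∑-+ (f ∘ (false ∷_)) (g ∘ (false ∷_))) (∑-+ (f ∘ (true ∷_)) (g ∘ (true ∷_))))
  (+-interchange (∑ (f ∘ (false ∷_))) (∑ (g ∘ (false ∷_))) (∑ (f ∘ (true ∷_))) (∑ (g ∘ (true ∷_))))

∑-*ˡ : ∀ {m} c (f : Vec Bool m → ℤ) → ∑ (λ x → c ℤ.* f x) ≡ c ℤ.* ∑ f
∑-*ˡ {zero}  c f = refl
∑-*ˡ {suc m} c f = trans
  (cong₂ ℤ._+_ (∑-*ˡ c (f ∘ (false ∷_))) (∑-*ˡ c (f ∘ (true ∷_))))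
  (sym (ℤ.*-distribˡ-+ c (∑ (f ∘ (false ∷_))) (∑ (f ∘ (true ∷_)))))

-- Λ is a sum over another cube or over the seeds.
∑-swap : ∀ {A : Set} (Λ : (A → ℤ) → ℤ) → (∀ f g → Λ (λ a → f a ℤ.+ g a) ≡ Λ f ℤ.+ Λ g) →
         ∀ {m} (f : Vec Bool m → A → ℤ) → ∑ (λ x → Λ (f x)) ≡ Λ (λ a → ∑ (λ x → f x a))
∑-swap Λ additive {zero}  f = refl
∑-swap Λ additive {suc m} f = trans
  (cong₂ ℤ._+_ (∑-swap Λ additive (f ∘ (false ∷_))) (∑-swap Λ additive (f ∘ (true ∷_))))
  (sym (additive _ _))

∑-mono : ∀ {m} {f g : Vec Bool m → ℤ} → (∀ x → f x ℤ.≤ g x) → ∑ f ℤ.≤ ∑ g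
∑-mono {zero}  f≤g = f≤g []
∑-mono {suc m} f≤g = ℤ.+-mono-≤ (∑-mono (f≤g ∘ (false ∷_))) (∑-mono (f≤g ∘ (true ∷_)))

2^ : ℕ → ℤ
2^ m = (+ 2) ℤ.^ m

∑-const : ∀ m c → ∑ {m} (λ _ → c) ≡ 2^ m ℤ.* c
∑-const zero    c = sym (ℤ.*-identityˡ c)
∑-const (suc m) c = trans (cong₂ ℤ._+_ (∑-const m c) (∑-const m c)) (lemma (2^ m) c)
  where
  lemma : ∀ p c → p ℤ.* c ℤ.+ p ℤ.* c ≡ + 2 ℤ.* p ℤ.* c
  lemma = ℤ.solve-∀

∣∑∣≤ : ∀ {m} {f : Vec Bool m → ℤ} {B} → (∀ x → ∣ f x ∣ ≤ B) → ∣ ∑ f ∣ ≤ 2 ^ m * B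
∣∑∣≤ {zero}  {B = B} f≤B = subst (_ ≤_) (sym (ℕ.*-identityˡ B)) (f≤B [])
∣∑∣≤ {suc m} {f} {B} f≤B = begin
  ∣ ∑ f₀ ℤ.+ ∑ f₁ ∣      ≤⟨ ℤ.∣i+j∣≤∣i∣+∣j∣ (∑ f₀) (∑ f₁) ⟩
  ∣ ∑ f₀ ∣ + ∣ ∑ f₁ ∣    ≤⟨ ℕ.+-mono-≤ (∣∑∣≤ (f≤B ∘ (false ∷_))) (∣∑∣≤ (f≤B ∘ (true ∷_))) ⟩
  2 ^ m * B + 2 ^ m * B  ≡⟨ ℕ.*-distribʳ-+ B (2 ^ m) (2 ^ m) ⟨
  (2 ^ m + 2 ^ m) * B    ≡⟨ cong (λ t → (2 ^ m + t) * B) (ℕ.+-identityʳ (2 ^ m)) ⟨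
  2 ^ suc m * B          ∎
  where
  open ℕ.≤-Reasoning
  f₀ = f ∘ (false ∷_)
  f₁ = f ∘ (true ∷_)

sq : ℤ → ℤ
sq i = i ℤ.* i

sq≥0 : ∀ i → 0ℤ ℤ.≤ sq i
sq≥0 (+ n)      = subst (0ℤ ℤ.≤_) (ℤ.pos-* n n) (ℤ.+≤+ z≤n)
sq≥0 ℤ.-[1+ n ] = ℤ.+≤+ z≤n

-- The two sides differ by the square of `a ℤ.+ - b`.
sq-+≤ : ∀ a b → sq (a ℤ.+ b) ℤ.≤ + 2 ℤ.* (sq a ℤ.+ sq b)
sq-+≤ a b = begin
  sq (a ℤ.+ b)                     ≡⟨ ℤ.+-identityʳ _ ⟨
  sq (a ℤ.+ b) ℤ.+ 0ℤ              ≤⟨ ℤ.+-monoʳ-≤ (sq (a ℤ.+ b)) (sq≥0 (a ℤ.+ - b)) ⟩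
  sq (a ℤ.+ b) ℤ.+ sq (a ℤ.+ - b)  ≡⟨ parallelogram a b ⟩
  + 2 ℤ.* (sq a ℤ.+ sq b)          ∎
  where
  open ℤ.≤-Reasoning
  parallelogram : ∀ a b → (a ℤ.+ b) ℤ.* (a ℤ.+ b) ℤ.+ (a ℤ.+ - b) ℤ.* (a ℤ.+ - b) ≡ + 2 ℤ.* (a ℤ.* a ℤ.+ b ℤ.* b)
  parallelogram = ℤ.solve-∀

0≤2^ : ∀ m → 0ℤ ℤ.≤ 2^ m
0≤2^ zero    = ℤ.+≤+ z≤n
0≤2^ (suc m) = ℤ.*-monoˡ-≤-nonNeg (+ 2) (0≤2^ m)

*2^-mono : ∀ m {i j} → i ℤ.≤ j → 2^ m ℤ.* i ℤ.≤ 2^ m ℤ.* j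
*2^-mono m = ℤ.*-monoˡ-≤-nonNeg (2^ m) {{ℤ.nonNegative (0≤2^ m)}}

-- Cauchy-Schwarz against the constant function 1: each coordinate that is split off costs a factor
-- 2 through `sq-+≤`.
sq-∑≤ : ∀ {m} (f : Vec Bool m → ℤ) → sq (∑ f) ℤ.≤ 2^ m ℤ.* ∑ (sq ∘ f)
sq-∑≤ {zero}  f = ℤ.≤-reflexive (sym (ℤ.*-identityˡ (sq (f []))))
sq-∑≤ {suc m} f = begin
  sq (∑ f₀ ℤ.+ ∑ f₁)                                       ≤⟨ sq-+≤ (∑ f₀) (∑ f₁) ⟩
  + 2 ℤ.* (sq (∑ f₀) ℤ.+ sq (∑ f₁))                        ≤⟨ ℤ.*-monoˡ-≤-nonNeg (+ 2) (ℤ.+-mono-≤ (sq-∑≤ f₀) (sq-∑≤ f₁)) ⟩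
  + 2 ℤ.* (2^ m ℤ.* ∑ (sq ∘ f₀) ℤ.+ 2^ m ℤ.* ∑ (sq ∘ f₁))  ≡⟨ lemma (2^ m) (∑ (sq ∘ f₀)) (∑ (sq ∘ f₁)) ⟩
  2^ (suc m) ℤ.* ∑ (sq ∘ f)                                ∎
  where
  open ℤ.≤-Reasoning
  f₀ = f ∘ (false ∷_)
  f₁ = f ∘ (true ∷_)
  lemma : ∀ p a b → + 2 ℤ.* (p ℤ.* a ℤ.+ p ℤ.* b) ≡ + 2 ℤ.* p ℤ.* (a ℤ.+ b)
  lemma = ℤ.solve-∀

sgn : Bool → ℤ
sgn false = 1ℤ
sgn true  = -1ℤ

sgn-xor : ∀ a b → sgn (a xor b) ≡ sgn a ℤ.* sgn b
sgn-xor false b     = sym (ℤ.*-identityˡ (sgn b))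
sgn-xor true  false = refl
sgn-xor true  true  = refl

∣sgn∣ : ∀ b → ∣ sgn b ∣ ≤ 1
∣sgn∣ false = ℕ.≤-refl
∣sgn∣ true  = ℕ.≤-refl

dot : ∀ {m} → Vec Bool m → Vec Bool m → Bool
dot []      []      = false
dot (a ∷ x) (b ∷ y) = (a ∧ b) xor dot x y

-- The Sylvester-Hadamard matrix of order `2 ^ m`.
H : ∀ {m} → Vec Bool m → Vec Bool m → ℤ
H x y = sgn (dot x y)

-- Splitting off the first bits turns the inner sum into P + Q where that bit of `x` is 0 and into P
-- - Q where it is 1. The squares combine by the parallelogram law, and the induction hypothesis
-- applies to both halves of `w`.
parseval : ∀ {m} (w : Vec Bool m → ℤ) → ∑ (λ x → sq (∑ (λ y → w y ℤ.* H x y))) ≡ 2^ m ℤ.* ∑ (sq ∘ w)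
parseval {zero} w = lemma (w [])
  where
  lemma : ∀ a → a ℤ.* 1ℤ ℤ.* (a ℤ.* 1ℤ) ≡ 1ℤ ℤ.* (a ℤ.* a)
  lemma = ℤ.solve-∀
parseval {suc m} w = begin
  ∑ (λ x → sq (P x ℤ.+ Q x)) ℤ.+ ∑ (λ x → sq (P x ℤ.+ ∑ (λ y → w₁ y ℤ.* sgn (true xor dot x y))))
    ≡⟨ cong (λ t → ∑ (λ x → sq (P x ℤ.+ Q x)) ℤ.+ t) (∑-cong λ x → cong (λ t → sq (P x ℤ.+ t)) (minus x)) ⟩
  ∑ (λ x → sq (P x ℤ.+ Q x)) ℤ.+ ∑ (λ x → sq (P x ℤ.+ -1ℤ ℤ.* Q x))
    ≡⟨ ∑-+ (λ x → sq (P x ℤ.+ Q x)) (λ x → sq (P x ℤ.+ -1ℤ ℤ.* Q x)) ⟨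
  ∑ (λ x → sq (P x ℤ.+ Q x) ℤ.+ sq (P x ℤ.+ -1ℤ ℤ.* Q x))
    ≡⟨ ∑-cong (λ x → parallelogram (P x) (Q x)) ⟩
  ∑ (λ x → + 2 ℤ.* (sq (P x) ℤ.+ sq (Q x)))
    ≡⟨ ∑-*ˡ (+ 2) (λ x → sq (P x) ℤ.+ sq (Q x)) ⟩
  + 2 ℤ.* ∑ (λ x → sq (P x) ℤ.+ sq (Q x))
    ≡⟨ cong (+ 2 ℤ.*_) (∑-+ (sq ∘ P) (sq ∘ Q)) ⟩
  + 2 ℤ.* (∑ (sq ∘ P) ℤ.+ ∑ (sq ∘ Q))
    ≡⟨ cong (+ 2 ℤ.*_) (cong₂ ℤ._+_ (parseval w₀) (parseval w₁)) ⟩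
  + 2 ℤ.* (2^ m ℤ.* ∑ (sq ∘ w₀) ℤ.+ 2^ m ℤ.* ∑ (sq ∘ w₁))
    ≡⟨ factor (2^ m) (∑ (sq ∘ w₀)) (∑ (sq ∘ w₁)) ⟩
  2^ (suc m) ℤ.* ∑ (sq ∘ w) ∎
  where
  open ≡-Reasoning
  w₀ = w ∘ (false ∷_)
  w₁ = w ∘ (true ∷_)
  P Q : Vec Bool m → ℤ
  P x = ∑ (λ y → w₀ y ℤ.* H x y)
  Q x = ∑ (λ y → w₁ y ℤ.* H x y)
  parallelogram : ∀ a b → (a ℤ.+ b) ℤ.* (a ℤ.+ b) ℤ.+ (a ℤ.+ -1ℤ ℤ.* b) ℤ.* (a ℤ.+ -1ℤ ℤ.* b) ≡ + 2 ℤ.* (a ℤ.* a ℤ.+ b ℤ.* b)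
  parallelogram = ℤ.solve-∀
  factor : ∀ p a b → + 2 ℤ.* (p ℤ.* a ℤ.+ p ℤ.* b) ≡ + 2 ℤ.* p ℤ.* (a ℤ.+ b)
  factor = ℤ.solve-∀
  pull : ∀ a b → a ℤ.* (-1ℤ ℤ.* b) ≡ -1ℤ ℤ.* (a ℤ.* b)
  pull = ℤ.solve-∀
  minus : ∀ x → ∑ (λ y → w₁ y ℤ.* sgn (true xor dot x y)) ≡ -1ℤ ℤ.* Q x
  minus x = trans
    (∑-cong λ y → trans (cong (w₁ y ℤ.*_) (sgn-xor true (dot x y))) (pull (w₁ y) (H x y)))
    (∑-*ˡ -1ℤ (λ y → w₁ y ℤ.* H x y))

-- Weights take the place of the indicator functions of the sides of a rectangle. Their products are
-- again weights, so conditions on messages and the final output can be absorbed into them.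
Weight : ∀ {A : Set} → (A → ℤ) → Set
Weight u = ∀ x → ∣ u x ∣ ≤ 1

sq-abs : ∀ i → sq i ≡ + (∣ i ∣ * ∣ i ∣)
sq-abs (+ n)      = sym (ℤ.pos-* n n)
sq-abs ℤ.-[1+ n ] = refl

sq-weight : ∀ i → ∣ i ∣ ≤ 1 → sq i ℤ.≤ 1ℤ
sq-weight i i≤1 = subst (ℤ._≤ 1ℤ) (sym (sq-abs i)) (ℤ.+≤+ (ℕ.*-mono-≤ i≤1 i≤1))

sq-weight-* : ∀ i j → ∣ i ∣ ≤ 1 → sq (i ℤ.* j) ℤ.≤ sq j
sq-weight-* i j i≤1 = begin
  sq (i ℤ.* j)   ≡⟨ lemma i j ⟩
  sq j ℤ.* sq i  ≤⟨ ℤ.*-monoˡ-≤-nonNeg (sq j) {{ℤ.nonNegative (sq≥0 j)}} (sq-weight i i≤1) ⟩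
  sq j ℤ.* 1ℤ    ≡⟨ ℤ.*-identityʳ (sq j) ⟩
  sq j           ∎
  where
  open ℤ.≤-Reasoning
  lemma : ∀ i j → i ℤ.* j ℤ.* (i ℤ.* j) ≡ j ℤ.* j ℤ.* (i ℤ.* i)
  lemma = ℤ.solve-∀

correlation : ∀ {m} (u v : Vec Bool m → ℤ) → (Vec Bool m → Vec Bool m → ℤ) → ℤ
correlation u v K = ∑ (λ x → u x ℤ.* ∑ (λ y → v y ℤ.* K x y))

-- Lindsey's lemma.
sq-correlation≤ : ∀ {m} {u v : Vec Bool m → ℤ} → Weight u → Weight v →
                  sq (correlation u v H) ℤ.≤ 2^ m ℤ.* (2^ m ℤ.* 2^ m)
sq-correlation≤ {m} {u} {v} ∣u∣≤1 ∣v∣≤1 = begin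
  sq (∑ (λ x → u x ℤ.* ψ x))            ≤⟨ sq-∑≤ (λ x → u x ℤ.* ψ x) ⟩
  2^ m ℤ.* ∑ (λ x → sq (u x ℤ.* ψ x))   ≤⟨ *2^-mono m (∑-mono λ x → sq-weight-* (u x) (ψ x) (∣u∣≤1 x)) ⟩
  2^ m ℤ.* ∑ (sq ∘ ψ)                   ≡⟨ cong (2^ m ℤ.*_) (parseval v) ⟩
  2^ m ℤ.* (2^ m ℤ.* ∑ (sq ∘ v))        ≤⟨ *2^-mono m (*2^-mono m (∑-mono λ y → sq-weight (v y) (∣v∣≤1 y))) ⟩
  2^ m ℤ.* (2^ m ℤ.* ∑ {m} (λ _ → 1ℤ))  ≡⟨ cong (λ t → 2^ m ℤ.* (2^ m ℤ.* t)) (trans (∑-const m 1ℤ) (ℤ.*-identityʳ (2^ m))) ⟩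
  2^ m ℤ.* (2^ m ℤ.* 2^ m)              ∎
  where
  open ℤ.≤-Reasoning
  ψ : Vec Bool m → ℤ
  ψ x = ∑ (λ y → v y ℤ.* H x y)

sq-cancel-≤ : ∀ {a b} → a * a ≤ b * b → a ≤ b
sq-cancel-≤ {a} {b} aa≤bb = ℕ.≮⇒≥ λ b<a → ℕ.<⇒≱ (ℕ.*-mono-< b<a b<a) aa≤bb

-- An even dimension avoids square roots: the cube of `2 ^ (r * 2)` is the square of `8 ^ r`.
correlation≤ : ∀ r {u v : Vec Bool (r * 2) → ℤ} → Weight u → Weight v →
               ∣ correlation u v H ∣ ≤ 8 ^ r
correlation≤ r {u} {v} ∣u∣≤1 ∣v∣≤1 = sq-cancel-≤ (ℤ.drop‿+≤+ (subst₂ ℤ._≤_ (sq-abs (correlation u v H)) (cubes r)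
    (sq-correlation≤ {u = u} {v} ∣u∣≤1 ∣v∣≤1)))
  where
  cubes : ∀ r → 2^ (r * 2) ℤ.* (2^ (r * 2) ℤ.* 2^ (r * 2)) ≡ + (8 ^ r * 8 ^ r)
  cubes zero    = refl
  cubes (suc r) = begin
    2^ (suc r * 2) ℤ.* (2^ (suc r * 2) ℤ.* 2^ (suc r * 2))  ≡⟨ step (2^ (r * 2)) ⟩
    + 64 ℤ.* (2^ (r * 2) ℤ.* (2^ (r * 2) ℤ.* 2^ (r * 2)))   ≡⟨ cong (+ 64 ℤ.*_) (cubes r) ⟩
    + 64 ℤ.* + (8 ^ r * 8 ^ r)                              ≡⟨ ℤ.pos-* 64 (8 ^ r * 8 ^ r) ⟨
    + (64 * (8 ^ r * 8 ^ r))                                ≡⟨ cong +_ (ℕ.[m*n]*[o*p]≡[m*o]*[n*p] 8 8 (8 ^ r) (8 ^ r)) ⟩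
    + (8 * 8 ^ r * (8 * 8 ^ r))                             ∎
    where
    open ≡-Reasoning
    step : ∀ p → + 2 ℤ.* (+ 2 ℤ.* p) ℤ.* (+ 2 ℤ.* (+ 2 ℤ.* p) ℤ.* (+ 2 ℤ.* (+ 2 ℤ.* p))) ≡ + 64 ℤ.* (p ℤ.* (p ℤ.* p))
    step = ℤ.solve-∀

correlation-cong : ∀ {m} (u v : Vec Bool m → ℤ) {K K′} → (∀ x y → K x y ≡ K′ x y) →
                   correlation u v K ≡ correlation u v K′
correlation-cong u v K≗K′ = ∑-cong λ x → cong (u x ℤ.*_) (∑-cong λ y → cong (v y ℤ.*_) (K≗K′ x y))

-- Exchanging the two sums lets Bob's messages be eliminated in the same way as Alice's.
correlation-flip : ∀ {m} (u v : Vec Bool m → ℤ) K →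
                   correlation u v K ≡ correlation v u (λ y x → K x y)
correlation-flip u v K = begin
  ∑ (λ x → u x ℤ.* ∑ (λ y → v y ℤ.* K x y))    ≡⟨ ∑-cong (λ x → sym (∑-*ˡ (u x) (λ y → v y ℤ.* K x y))) ⟩
  ∑ (λ x → ∑ (λ y → u x ℤ.* (v y ℤ.* K x y)))  ≡⟨ ∑-swap ∑ ∑-+ (λ x y → u x ℤ.* (v y ℤ.* K x y)) ⟩
  ∑ (λ y → ∑ (λ x → u x ℤ.* (v y ℤ.* K x y)))  ≡⟨ ∑-cong (λ y → ∑-cong λ x → exchange (u x) (v y) (K x y)) ⟩
  ∑ (λ y → ∑ (λ x → v y ℤ.* (u x ℤ.* K x y)))  ≡⟨ ∑-cong (λ y → ∑-*ˡ (v y) (λ x → u x ℤ.* K x y)) ⟩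
  ∑ (λ y → v y ℤ.* ∑ (λ x → u x ℤ.* K x y))    ∎
  where
  open ≡-Reasoning
  exchange : ∀ a b c → a ℤ.* (b ℤ.* c) ≡ b ℤ.* (a ℤ.* c)
  exchange = ℤ.solve-∀

-- Two-party protocols

δ : ∀ {s} → Vec Bool s → Vec Bool s → ℤ
δ []          []          = 1ℤ
δ (false ∷ a) (false ∷ b) = δ a b
δ (true  ∷ a) (true  ∷ b) = δ a b
δ (false ∷ a) (true  ∷ b) = 0ℤ
δ (true  ∷ a) (false ∷ b) = 0ℤ

∣δ∣≤1 : ∀ {s} (a b : Vec Bool s) → ∣ δ a b ∣ ≤ 1
∣δ∣≤1 []          []          = ℕ.≤-refl
∣δ∣≤1 (false ∷ a) (false ∷ b) = ∣δ∣≤1 a b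
∣δ∣≤1 (true  ∷ a) (true  ∷ b) = ∣δ∣≤1 a b
∣δ∣≤1 (false ∷ a) (true  ∷ b) = z≤n
∣δ∣≤1 (true  ∷ a) (false ∷ b) = z≤n

∑-zero : ∀ {m} (f : Vec Bool m → ℤ) → ∑ (λ x → 0ℤ ℤ.* f x) ≡ 0ℤ
∑-zero f = ∑-*ˡ 0ℤ f

∑-δ : ∀ {s} (a : Vec Bool s) (f : Vec Bool s → ℤ) → ∑ (λ b → δ a b ℤ.* f b) ≡ f a
∑-δ []          f = ℤ.*-identityˡ (f [])
∑-δ (false ∷ a) f = trans (cong₂ ℤ._+_ (∑-δ a (f ∘ (false ∷_))) (∑-zero (f ∘ (true ∷_)))) (ℤ.+-identityʳ _)
∑-δ (true  ∷ a) f = trans (cong₂ ℤ._+_ (∑-zero (f ∘ (false ∷_))) (∑-δ a (f ∘ (true ∷_)))) (ℤ.+-identityˡ _)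

-- The message φ x is eliminated by summing over its 2 ^ s possible values a; the
-- condition φ x ≡ a is absorbed into the weight u.
correlation-message : ∀ {m s} (u v : Vec Bool m → ℤ) (φ : Vec Bool m → Vec Bool s)
  (K : Vec Bool s → Vec Bool m → Vec Bool m → ℤ) {B} → Weight u →
  (∀ a {u′} → Weight u′ → ∣ correlation u′ v (K a) ∣ ≤ B) →
  ∣ correlation u v (λ x → K (φ x) x) ∣ ≤ 2 ^ s * B
correlation-message u v φ K {B} ∣u∣≤1 bound = subst (λ t → ∣ t ∣ ≤ _) (sym split) (∣∑∣≤ λ a → bound a {u[ a ]} (weight a))
  where
  u[_] : _ → _ → ℤ
  u[ a ] x = δ (φ x) a ℤ.* u x
  weight : ∀ a → Weight u[ a ]
  weight a x = subst (_≤ 1) (sym (ℤ.abs-* (δ (φ x) a) (u x))) (ℕ.*-mono-≤ (∣δ∣≤1 (φ x) a) (∣u∣≤1 x))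
  split : correlation u v (λ x → K (φ x) x) ≡ ∑ (λ a → correlation u[ a ] v (K a))
  split = begin
    ∑ (λ x → F (φ x) x)                      ≡⟨ ∑-cong (λ x → sym (∑-δ (φ x) (λ a → F a x))) ⟩
    ∑ (λ x → ∑ (λ a → δ (φ x) a ℤ.* F a x))  ≡⟨ ∑-swap ∑ ∑-+ (λ x a → δ (φ x) a ℤ.* F a x) ⟩
    ∑ (λ a → ∑ (λ x → δ (φ x) a ℤ.* F a x))  ≡⟨ ∑-cong (λ a → ∑-cong λ x → sym (ℤ.*-assoc (δ (φ x) a) (u x) _)) ⟩
    ∑ (λ a → correlation u[ a ] v (K a))     ∎
    where
    open ≡-Reasoning
    F : _ → _ → ℤ
    F a x = u x ℤ.* ∑ (λ y → v y ℤ.* K a x y)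

-- One pass over the stream: the effect of Alice's tokens on the memory, then that of Bob's. The
-- messages are the memory contents.
Round : ℕ → ℕ → Set
Round m s = (Vec Bool m → Vec Bool s → Vec Bool s) × (Vec Bool m → Vec Bool s → Vec Bool s)

run : ∀ {m s} → List (Round m s) → Vec Bool m → Vec Bool m → Vec Bool s → Vec Bool s
run []             x y a = a
run ((α , β) ∷ πs) x y a = run πs x y (β y (α x a))

-- Fixing the two messages of a round costs a factor `2 ^ s` each and leaves a shorter protocol with
-- a known initial memory and other weights; hence the induction is over all `a`, `u` and `v`.
-- Without rounds the output is constant and `correlation≤` applies.
protocol-correlation≤ : ∀ r {s} (πs : List (Round (r * 2) s)) (a : Vec Bool s) (g : Vec Bool s → ℤ) → Weight g →
  ∀ {u v} → Weight u → Weight v →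
  ∣ correlation u v (λ x y → H x y ℤ.* g (run πs x y a)) ∣ ≤ (2 ^ s * 2 ^ s) ^ length πs * 8 ^ r
protocol-correlation≤ r {s} [] a g ∣g∣≤1 {u} {v} ∣u∣≤1 ∣v∣≤1 = begin
  ∣ correlation u v (λ x y → H x y ℤ.* g a) ∣  ≡⟨ cong ∣_∣ absorb ⟩
  ∣ correlation u v′ H ∣                       ≤⟨ correlation≤ r {u} {v′} ∣u∣≤1 ∣v′∣≤1 ⟩
  8 ^ r                                        ≡⟨ ℕ.*-identityˡ (8 ^ r) ⟨
  1 * 8 ^ r                                    ∎
  where
  open ℕ.≤-Reasoning
  v′ : _ → ℤ
  v′ y = v y ℤ.* g a
  ∣v′∣≤1 : Weight v′
  ∣v′∣≤1 y = subst (_≤ 1) (sym (ℤ.abs-* (v y) (g a))) (ℕ.*-mono-≤ (∣v∣≤1 y) (∣g∣≤1 a))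
  exchange : ∀ a b c → a ℤ.* (b ℤ.* c) ≡ a ℤ.* c ℤ.* b
  exchange = ℤ.solve-∀
  absorb : correlation u v (λ x y → H x y ℤ.* g a) ≡ correlation u v′ H
  absorb = ∑-cong λ x → cong (u x ℤ.*_) (∑-cong λ y → exchange (v y) (H x y) (g a))
protocol-correlation≤ r {s} ((α , β) ∷ πs) a g ∣g∣≤1 {u} {v} ∣u∣≤1 ∣v∣≤1 = begin
  ∣ correlation u v (λ x y → K (β y (α x a)) x y) ∣
    ≤⟨ correlation-message u v (λ x → α x a) (λ b x y → K (β y b) x y) ∣u∣≤1 (λ b {u′} → bob b {u′}) ⟩
  2 ^ s * (2 ^ s * ((2 ^ s * 2 ^ s) ^ length πs * 8 ^ r))
    ≡⟨ reassoc (2 ^ s) ((2 ^ s * 2 ^ s) ^ length πs) (8 ^ r) ⟩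
  (2 ^ s * 2 ^ s) * (2 ^ s * 2 ^ s) ^ length πs * 8 ^ r ∎
  where
  open ℕ.≤-Reasoning
  K : _ → _ → _ → ℤ
  K c x y = H x y ℤ.* g (run πs x y c)
  bob : ∀ b {u′} → Weight u′ → ∣ correlation u′ v (λ x y → K (β y b) x y) ∣ ≤
        2 ^ s * ((2 ^ s * 2 ^ s) ^ length πs * 8 ^ r)
  -- With Alice's message fixed to `b`, Bob's depends on `y` alone. The correlation is flipped,
  -- Bob's message is eliminated, and each resulting term is flipped back.
  bob b {u′} ∣u′∣≤1 = subst (λ t → ∣ t ∣ ≤ _) (sym (correlation-flip u′ v _))
    (correlation-message v u′ (λ y → β y b) (λ c y x → K c x y) ∣v∣≤1 λ c {v′} ∣v′∣≤1 →
      subst (λ t → ∣ t ∣ ≤ _) (correlation-flip u′ v′ (K c))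
        (protocol-correlation≤ r πs c g ∣g∣≤1 {u′} {v′} ∣u′∣≤1 ∣v′∣≤1))
  reassoc : ∀ t p e → t * (t * (p * e)) ≡ t * t * p * e
  reassoc t p e = trans (sym (ℕ.*-assoc t t _)) (sym (ℕ.*-assoc (t * t) p e))

-- Averaging over the seeds

sumℤ-mono : ∀ {n} {f g : Fin n → ℤ} → (∀ i → f i ℤ.≤ g i) → sumℤ f ℤ.≤ sumℤ g
sumℤ-mono {zero}  f≤g = ℤ.≤-refl
sumℤ-mono {suc n} f≤g = ℤ.+-mono-≤ (f≤g zero) (sumℤ-mono (f≤g ∘ suc))

sumℤ-const : ∀ n c → sumℤ {n} (λ _ → c) ≡ + n ℤ.* c
sumℤ-const zero    c = refl
sumℤ-const (suc n) c = trans (cong (λ t → c ℤ.+ t) (sumℤ-const n c)) (sym (ℤ.suc-* (+ n) c))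

sumℤ-*ˡ : ∀ {n} c (f : Fin n → ℤ) → sumℤ (λ i → c ℤ.* f i) ≡ c ℤ.* sumℤ f
sumℤ-*ˡ {zero}  c f = sym (ℤ.*-zeroʳ c)
sumℤ-*ˡ {suc n} c f = trans (cong (λ t → c ℤ.* f zero ℤ.+ t) (sumℤ-*ˡ c (f ∘ suc))) (sym (ℤ.*-distribˡ-+ c (f zero) _))

sumℤ-sgn : ∀ {n} (E : Fin n → Bool) → sumℤ (sgn ∘ E) ℤ.+ + 2 ℤ.* + ∥ tabulate E ∥ ≡ + n
sumℤ-sgn {zero}  E = refl
sumℤ-sgn {suc n} E with E zero
... | false = trans (ℤ.+-assoc 1ℤ (sumℤ (sgn ∘ E ∘ suc)) _) (cong (λ t → 1ℤ ℤ.+ t) (sumℤ-sgn (E ∘ suc)))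
... | true  = trans (trans (cong (λ t → -1ℤ ℤ.+ sumℤ (sgn ∘ E ∘ suc) ℤ.+ + 2 ℤ.* t) (ℤ.pos-+ 1 ∥ tabulate (E ∘ suc) ∥))
                (lemma (sumℤ (sgn ∘ E ∘ suc)) (+ ∥ tabulate (E ∘ suc) ∥)))
                (cong (λ t → 1ℤ ℤ.+ t) (sumℤ-sgn (E ∘ suc)))
  where
  lemma : ∀ a b → -1ℤ ℤ.+ a ℤ.+ + 2 ℤ.* (1ℤ ℤ.+ b) ≡ 1ℤ ℤ.+ (a ℤ.+ + 2 ℤ.* b)
  lemma = ℤ.solve-∀

-- With a success counted as 1 and a failure as -1, at least two thirds of successes give a surplus
-- of at least a third of the seeds.
likely⇒advantage : ∀ {n} {{_ : NonZero n}} (E : Fin n → Bool) → + 2 / 3 ≤ℚ Pr E →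
                   + n ℤ.≤ + 3 ℤ.* sumℤ (λ i → -1ℤ ℤ.* sgn (E i))
likely⇒advantage {suc n} E (*≤* 2n≤3E) = begin
  N                                                      ≡⟨ lemma₁ N ⟩
  + 2 ℤ.* (+ 2 ℤ.* N) ℤ.+ - (+ 3 ℤ.* N)                  ≤⟨ ℤ.+-monoˡ-≤ (- (+ 3 ℤ.* N)) (ℤ.*-monoˡ-≤-nonNeg (+ 2) 2n≤3E) ⟩
  + 2 ℤ.* (C ℤ.* + 3) ℤ.+ - (+ 3 ℤ.* N)                  ≡⟨ cong (λ t → + 2 ℤ.* (C ℤ.* + 3) ℤ.+ - (+ 3 ℤ.* t)) (sym (sumℤ-sgn E)) ⟩
  + 2 ℤ.* (C ℤ.* + 3) ℤ.+ - (+ 3 ℤ.* (S ℤ.+ + 2 ℤ.* C))  ≡⟨ lemma₂ C S ⟩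
  + 3 ℤ.* (-1ℤ ℤ.* S)                                    ≡⟨ cong (λ t → + 3 ℤ.* t) (sumℤ-*ˡ -1ℤ (sgn ∘ E)) ⟨
  + 3 ℤ.* sumℤ (λ i → -1ℤ ℤ.* sgn (E i))                 ∎
  where
  open ℤ.≤-Reasoning
  N = + suc n
  C = + ∥ tabulate E ∥
  S = sumℤ (sgn ∘ E)
  lemma₁ : ∀ a → a ≡ + 2 ℤ.* (+ 2 ℤ.* a) ℤ.+ - (+ 3 ℤ.* a)
  lemma₁ = ℤ.solve-∀
  lemma₂ : ∀ c s → + 2 ℤ.* (c ℤ.* + 3) ℤ.+ - (+ 3 ℤ.* (s ℤ.+ + 2 ℤ.* c)) ≡ + 3 ℤ.* (-1ℤ ℤ.* s)
  lemma₂ = ℤ.solve-∀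

sgn-not : ∀ b → -1ℤ ℤ.* sgn (not b) ≡ 1ℤ ℤ.* sgn b
sgn-not false = refl
sgn-not true  = refl

i≤+∣i∣ : ∀ i → i ℤ.≤ + ∣ i ∣
i≤+∣i∣ (+ n)      = ℤ.≤-refl
i≤+∣i∣ ℤ.-[1+ n ] = ℤ.-≤+

-- `H x y ℤ.* sgn (out ω x y)` is 1 when the output equals `dot x y` and -1 otherwise, which brings
-- the two guarantees into one form.
ip-advantage : ∀ {m R} {{_ : NonZero R}} (out : Fin R → Vec Bool m → Vec Bool m → Bool) →
  (∀ x y → dot x y ≡ true  → + 2 / 3 ≤ℚ Pr (λ ω → out ω x y)) →
  (∀ x y → dot x y ≡ false → + 2 / 3 ≤ℚ Pr (λ ω → not (out ω x y))) →
  ∀ x y → + R ℤ.≤ + 3 ℤ.* sumℤ (λ ω → H x y ℤ.* sgn (out ω x y))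
ip-advantage out odd even x y with dot x y in eq
... | true  = likely⇒advantage (λ ω → out ω x y) (odd x y eq)
... | false = subst (λ t → _ ℤ.≤ + 3 ℤ.* t) (sumℤ-cong λ ω → sgn-not (out ω x y))
                (likely⇒advantage (λ ω → not (out ω x y)) (even x y eq))

-- The easy direction of Yao's principle: the advantage holds for every pair `x`, `y`, hence on
-- average over all pairs, and after the sums are exchanged each seed contributes the correlation of
-- one deterministic function.
ip-hard : ∀ {m R} {{_ : NonZero R}} (out : Fin R → Vec Bool m → Vec Bool m → Bool) {B} →
  (∀ x y → dot x y ≡ true  → + 2 / 3 ≤ℚ Pr (λ ω → out ω x y)) →
  (∀ x y → dot x y ≡ false → + 2 / 3 ≤ℚ Pr (λ ω → not (out ω x y))) →
  (∀ ω → ∣ correlation (λ _ → 1ℤ) (λ _ → 1ℤ) (λ x y → H x y ℤ.* sgn (out ω x y)) ∣ ≤ B) →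
  2^ m ℤ.* 2^ m ℤ.≤ + 3 ℤ.* + B
ip-hard {m} {R@(suc R-1)} out {B} odd even bound = ℤ.*-cancelˡ-≤-pos _ _ (+ R) (begin
  + R ℤ.* (2^ m ℤ.* 2^ m)
    ≡⟨ rotate (+ R) (2^ m) ⟩
  2^ m ℤ.* (2^ m ℤ.* + R)
    ≡⟨ ∑-const m (2^ m ℤ.* + R) ⟨
  ∑ {m} (λ _ → 2^ m ℤ.* + R)
    ≡⟨ ∑-cong {m} (λ _ → ∑-const m (+ R)) ⟨
  ∑ {m} (λ x → ∑ {m} (λ y → + R))
    ≤⟨ ∑-mono {m} (λ x → ∑-mono {m} (λ y → ip-advantage out odd even x y)) ⟩
  ∑ (λ x → ∑ (λ y → + 3 ℤ.* sumℤ (λ ω → C ω x y)))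
    ≡⟨ ∑-cong (λ x → ∑-*ˡ (+ 3) (λ y → sumℤ (λ ω → C ω x y))) ⟩
  ∑ (λ x → + 3 ℤ.* ∑ (λ y → sumℤ (λ ω → C ω x y)))
    ≡⟨ ∑-*ˡ (+ 3) (λ x → ∑ (λ y → sumℤ (λ ω → C ω x y))) ⟩
  + 3 ℤ.* ∑ (λ x → ∑ (λ y → sumℤ (λ ω → C ω x y)))
    ≡⟨ cong (λ t → + 3 ℤ.* t) (∑-cong λ x → ∑-swap sumℤ sumℤ-+ (λ y ω → C ω x y)) ⟩
  + 3 ℤ.* ∑ (λ x → sumℤ (λ ω → ∑ (λ y → C ω x y)))
    ≡⟨ cong (λ t → + 3 ℤ.* t) (∑-swap sumℤ sumℤ-+ (λ x ω → ∑ (λ y → C ω x y))) ⟩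
  + 3 ℤ.* sumℤ (λ ω → ∑ (λ x → ∑ (λ y → C ω x y)))
    ≡⟨ cong (λ t → + 3 ℤ.* t) (sumℤ-cong λ ω → ∑-cong λ x →
         trans (∑-cong λ y → sym (ℤ.*-identityˡ (C ω x y))) (sym (ℤ.*-identityˡ _))) ⟩
  + 3 ℤ.* sumℤ S
    ≤⟨ ℤ.*-monoˡ-≤-nonNeg (+ 3) (sumℤ-mono {f = S} λ ω → ℤ.≤-trans (i≤+∣i∣ (S ω)) (ℤ.+≤+ (bound ω))) ⟩
  + 3 ℤ.* sumℤ {R} (λ _ → + B)
    ≡⟨ cong (λ t → + 3 ℤ.* t) (sumℤ-const R (+ B)) ⟩
  + 3 ℤ.* (+ R ℤ.* + B)
    ≡⟨ exchange (+ R) (+ B) ⟩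
  + R ℤ.* (+ 3 ℤ.* + B) ∎)
  where
  open ℤ.≤-Reasoning
  C : _ → _ → _ → ℤ
  C ω x y = H x y ℤ.* sgn (out ω x y)
  S : Fin R → ℤ
  S ω = correlation (λ _ → 1ℤ) (λ _ → 1ℤ) (C ω)
  rotate : ∀ a b → a ℤ.* (b ℤ.* b) ≡ b ℤ.* (b ℤ.* a)
  rotate = ℤ.solve-∀
  exchange : ∀ a b → + 3 ℤ.* (a ℤ.* b) ≡ a ℤ.* (+ 3 ℤ.* b)
  exchange = ℤ.solve-∀

-- The space bound for the inner product

2^-pos : ∀ m → 2^ m ≡ + (2 ^ m)
2^-pos zero    = refl
2^-pos (suc m) = trans (cong (λ t → + 2 ℤ.* t) (2^-pos m)) (sym (ℤ.pos-* 2 (2 ^ m)))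

-- Division by `8 ^ r` leaves 2^r ≤ 3 · 2^q with q = `(s + s) * p`, and the summand 2 arises from 3
-- < 2^2.
space-bound : ∀ r s p → 2^ (r * 2) ℤ.* 2^ (r * 2) ℤ.≤ + 3 ℤ.* + ((2 ^ s * 2 ^ s) ^ p * 8 ^ r) →
              r < 2 + (s + s) * p
space-bound r s p bound = ℕ.≰⇒> λ q≤r → ℕ.<⇒≱ (begin-strict
  3 * ((2 ^ s * 2 ^ s) ^ p * 8 ^ r)  ≡⟨ ℕ.*-assoc 3 ((2 ^ s * 2 ^ s) ^ p) (8 ^ r) ⟨
  3 * (2 ^ s * 2 ^ s) ^ p * 8 ^ r    ≡⟨ cong (λ t → 3 * t * 8 ^ r) power ⟩
  3 * 2 ^ q * 8 ^ r                  <⟨ ℕ.*-monoˡ-< (8 ^ r) {{ℕ.m^n≢0 8 r}} (ℕ.*-monoˡ-< (2 ^ q) {{ℕ.m^n≢0 2 q}} (ℕ.n<1+n 3)) ⟩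
  4 * 2 ^ q * 8 ^ r                  ≡⟨ cong (_* 8 ^ r) (ℕ.^-distribˡ-+-* 2 2 q) ⟨
  2 ^ (2 + q) * 8 ^ r                ≤⟨ ℕ.*-monoˡ-≤ (8 ^ r) (ℕ.^-monoʳ-≤ 2 q≤r) ⟩
  2 ^ r * 8 ^ r                      ≡⟨ sixteen r ⟩
  2 ^ (r * 2) * 2 ^ (r * 2)          ∎) boundℕ
  where
  open ℕ.≤-Reasoning
  q = (s + s) * p
  power : (2 ^ s * 2 ^ s) ^ p ≡ 2 ^ q
  power = trans (cong (_^ p) (sym (ℕ.^-distribˡ-+-* 2 s s))) (ℕ.^-*-assoc 2 (s + s) p)
  sixteen : ∀ r → 2 ^ r * 8 ^ r ≡ 2 ^ (r * 2) * 2 ^ (r * 2)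
  sixteen zero    = refl
  sixteen (suc r) = trans (ℕ.[m*n]*[o*p]≡[m*o]*[n*p] 2 (2 ^ r) 8 (8 ^ r))
    (trans (cong (16 *_) (sixteen r)) (lemma (2 ^ (r * 2))))
    where
    lemma : ∀ a → 16 * (a * a) ≡ 2 * (2 * a) * (2 * (2 * a))
    lemma = ℕ.solve-∀
  boundℕ : 2 ^ (r * 2) * 2 ^ (r * 2) ≤ 3 * ((2 ^ s * 2 ^ s) ^ p * 8 ^ r)
  boundℕ = ℤ.drop‿+≤+ (subst₂ ℤ._≤_
    (trans (cong₂ ℤ._*_ (2^-pos (r * 2)) (2^-pos (r * 2))) (sym (ℤ.pos-* (2 ^ (r * 2)) _)))
    (sym (ℤ.pos-* 3 ((2 ^ s * 2 ^ s) ^ p * 8 ^ r))) bound)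

sublinear⇒small : ∀ n p {{_ : NonZero p}} s → + s / 1 ≤ℚ (+ 1 / 100) *ℚ (+ n / p) → 50 * ((s + s) * p) ≤ n
sublinear⇒small n p@(suc _) s (*≤* s100p≤n) = subst (_≤ n) (lemma s p) (ℤ.drop‿+≤+ (subst₂ ℤ._≤_
  (sym (ℤ.pos-* s (100 * p))) (trans (ℤ.*-identityʳ (1ℤ ℤ.* + n)) (ℤ.*-identityˡ (+ n))) s100p≤n))
  where
  lemma : ∀ s p → s * (100 * p) ≡ 50 * ((s + s) * p)
  lemma = ℕ.solve-∀

-- Streams

module _ {Token : Set} {p s : ℕ} (A : Algorithm Token p s) where
  open Algorithm A

  pass-++ : ∀ ω i t σ τ m → pass ω i t (σ ++ τ) m ≡ pass ω i (length σ + t) τ (pass ω i t σ m)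
  pass-++ ω i t []      τ m = refl
  pass-++ ω i t (x ∷ σ) τ m = trans (pass-++ ω i (suc t) σ τ (step ω i t x m))
    (cong (λ t′ → pass ω i t′ τ (pass ω i (suc t) σ (step ω i t x m))) (ℕ.+-suc (length σ) t))

  -- The memory is handed over between `α x` and `β y`, twice per pass. A step may depend on the
  -- number of tokens read, so Bob must know where his tokens begin without knowing `x`; the common
  -- length `L` provides this.
  streaming⇒space : ∀ r (α β : Vec Bool (r * 2) → List Token) L → (∀ x → length (α x) ≡ L) →
    (∀ x y → SolvesInstance A (α x ++ β y) (dot x y ≡ true)) → r < 2 + (s + s) * p
  streaming⇒space r α β L ∣α∣≡L solves = space-bound r s p (ip-hard (λ ω x y → output (α x ++ β y) ω)
    (λ x y → proj₁ (solves x y))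
    (λ x y even → proj₂ (solves x y) (λ odd → contradiction (trans (sym odd) even) λ ()))
    bound)
    where
    rounds : Fin seeds → List (Fin p) → List (Round (r * 2) s)
    rounds ω = List.map (λ i → (λ x → pass ω i 0 (α x)) , (λ y → pass ω i (L + 0) (β y)))

    run-rounds : ∀ ω x y is m → foldl (λ m i → pass ω i 0 (α x ++ β y) m) m is ≡ run (rounds ω is) x y m
    run-rounds ω x y []       m = refl
    run-rounds ω x y (i ∷ is) m = trans
      (cong (λ m′ → foldl (λ m i → pass ω i 0 (α x ++ β y) m) m′ is)
        (trans (pass-++ ω i 0 (α x) (β y) m) (cong (λ l → pass ω i (l + 0) (β y) (pass ω i 0 (α x) m)) (∣α∣≡L x))))
      (run-rounds ω x y is _)

    length-rounds : ∀ ω → length (rounds ω (allFin p)) ≡ p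
    length-rounds ω = trans (List.length-map _ (allFin p)) (List.length-tabulate {n = p} id)

    bound : ∀ ω → ∣ correlation (λ _ → 1ℤ) (λ _ → 1ℤ) (λ x y → H x y ℤ.* sgn (output (α x ++ β y) ω)) ∣
            ≤ (2 ^ s * 2 ^ s) ^ p * 8 ^ r
    bound ω = subst₂ (λ c l → ∣ c ∣ ≤ (2 ^ s * 2 ^ s) ^ l * 8 ^ r)
      (correlation-cong (λ _ → 1ℤ) (λ _ → 1ℤ)
        (λ x y → cong (λ m → H x y ℤ.* sgn (accept ω m)) (sym (run-rounds ω x y (allFin p) (start ω)))))
      (length-rounds ω)
      (protocol-correlation≤ r (rounds ω (allFin p)) (start ω) (sgn ∘ accept ω) (λ m → ∣sgn∣ (accept ω m))
        {λ _ → 1ℤ} {λ _ → 1ℤ} (λ _ → ℕ.≤-refl) (λ _ → ℕ.≤-refl))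

tokens : ∀ {n} → (Fin n → List (Fin n)) → List (Fin n) → List (VAToken n)
tokens N []       = []
tokens N (v ∷ vs) = vertex v ∷ List.map (edge v) (N v) ++ tokens N vs

tokens-cong : ∀ {n} {N N′ : Fin n → List (Fin n)} {vs} → All (λ v → N v ≡ N′ v) vs → tokens N vs ≡ tokens N′ vs
tokens-cong []       = refl
tokens-cong (e ∷ es) = cong₂ (λ us σ → vertex _ ∷ List.map (edge _) us ++ σ) e (tokens-cong es)

length-tokens : ∀ {n} {N N′ : Fin n → List (Fin n)} {vs} → All (λ v → length (N v) ≡ length (N′ v)) vs →
                length (tokens N vs) ≡ length (tokens N′ vs)
length-tokens [] = refl
length-tokens {N = N} {N′} {v ∷ vs} (e ∷ es) = cong suc (begin
  length (List.map (edge v) (N v) ++ tokens N vs)            ≡⟨ List.length-++ (List.map (edge v) (N v)) ⟩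
  length (List.map (edge v) (N v)) + length (tokens N vs)    ≡⟨ cong (_+ _) (List.length-map (edge v) (N v)) ⟩
  length (N v) + length (tokens N vs)                        ≡⟨ cong₂ ℕ._+_ e (length-tokens es) ⟩
  length (N′ v) + length (tokens N′ vs)                      ≡⟨ cong (_+ _) (List.length-map (edge v) (N′ v)) ⟨
  length (List.map (edge v) (N′ v)) + length (tokens N′ vs)  ≡⟨ List.length-++ (List.map (edge v) (N′ v)) ⟨
  length (List.map (edge v) (N′ v) ++ tokens N′ vs)          ∎)
  where open ≡-Reasoning

filterᵇ-cong : ∀ {A : Set} {f g : A → Bool} {xs} → All (λ x → f x ≡ g x) xs → filterᵇ f xs ≡ filterᵇ g xs
filterᵇ-cong [] = refl
filterᵇ-cong {f = f} {g} {x ∷ _} (e ∷ es) with f x | g x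
... | true  | true  = cong (x ∷_) (filterᵇ-cong es)
... | false | false = filterᵇ-cong es

filterᵇ-none : ∀ {A : Set} {f : A → Bool} {xs} → All (λ x → f x ≡ false) xs → filterᵇ f xs ≡ []
filterᵇ-none {f = f} none = List.filter-none (T? ∘ f) (All.map (λ eq t → subst T eq t) none)

module _ {n : ℕ} (G : Graph (Fin n)) {Q : Fin n → Set} (independent : ∀ u v → Q u → Q v → adj G u v ≡ false)
         (base : List (Fin n)) {rest : List (VAToken n)} where

  -- The vertices `us` are the members of the current class that have already arrived. As the class
  -- is independent, all earlier neighbours of a new member lie in `base`. The rest of the stream is
  -- a continuation that receives `seen` only up to permutation.
  expose′ : ∀ us vs {seen} → All Q us → All Q vs → seen ↭ us ++ base →
            (∀ {seen′} → seen′ ↭ vs ++ us ++ base → VAFrom G seen′ rest) →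
            VAFrom G seen (tokens (λ v → filterᵇ (adj G v) base) vs ++ rest)
  expose′ us []       Qus Qvs        seen↭ k = k seen↭
  expose′ us (v ∷ vs) {seen} Qus (Qv ∷ Qvs) seen↭ k =
    subst (λ σ → VAFrom G seen (vertex v ∷ σ)) (sym (List.++-assoc (List.map (edge v) (filterᵇ (adj G v) base)) _ rest))
      (arrive v nbrs (expose′ (v ∷ us) vs (Qv ∷ Qus) Qvs (prep v seen↭)
        (λ seen′↭ → k (↭-trans seen′↭ (↭.shift v vs (us ++ base))))))
    where
    nbrs : filterᵇ (adj G v) base ↭ filterᵇ (adj G v) seen
    nbrs = ↭-sym (↭-trans (↭.filter-↭ (T? ∘ adj G v) seen↭) (↭-reflexive
      (trans (List.filter-++ (T? ∘ adj G v) us base)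
        (cong (_++ filterᵇ (adj G v) base) (filterᵇ-none (All.map (λ {u} → independent v u Qv) Qus))))))

  expose : ∀ vs {seen} → All Q vs → seen ↭ base → (∀ {seen′} → seen′ ↭ vs ++ base → VAFrom G seen′ rest) →
           VAFrom G seen (tokens (λ v → filterᵇ (adj G v) base) vs ++ rest)
  expose vs Qvs = expose′ [] vs [] Qvs

-- The strand graph

bit : Bool → ℕ
bit b = if b then 1 else 0

size≡sum : ∀ {n} (f : Fin n → Bool) → ∥ tabulate f ∥ ≡ sum (bit ∘ f)
size≡sum {zero}  f = refl
size≡sum {suc n} f with f zero
... | true  = cong suc (size≡sum (f ∘ suc))
... | false = size≡sum (f ∘ suc)

sum-++ : ∀ a {b} (f : Fin (a + b) → ℕ) → sum f ≡ sum (λ i → f (i ↑ˡ b)) + sum (λ i → f (a ↑ʳ i))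
sum-++ zero    f = refl
sum-++ (suc a) f = trans (cong (λ t → f zero + t) (sum-++ a (f ∘ suc))) (sym (ℕ.+-assoc (f zero) _ _))

sum-combine : ∀ a {b} (f : Fin (a * b) → ℕ) → sum f ≡ sum {a} (λ i → sum {b} (λ j → f (combine i j)))
sum-combine zero    f = refl
sum-combine (suc a) {b} f = trans (sum-++ b f) (cong (λ t → sum (λ i → f (i ↑ˡ (a * b))) + t) (sum-combine a (λ i → f (b ↑ʳ i))))

size-∨ : ∀ {n} (f g : Fin n → Bool) → ∥ tabulate (λ i → f i ∨ g i) ∥ ≤ ∥ tabulate f ∥ + ∥ tabulate g ∥
size-∨ {zero}  f g = z≤n
size-∨ {suc n} f g with f zero | g zero
... | false | false = size-∨ (f ∘ suc) (g ∘ suc)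
... | false | true  = ℕ.≤-trans (s≤s (size-∨ (f ∘ suc) (g ∘ suc))) (ℕ.≤-reflexive (sym (ℕ.+-suc _ _)))
... | true  | false = s≤s (size-∨ (f ∘ suc) (g ∘ suc))
... | true  | true  = s≤s (ℕ.≤-trans (size-∨ (f ∘ suc) (g ∘ suc)) (ℕ.+-monoʳ-≤ ∥ tabulate (f ∘ suc) ∥ (ℕ.n≤1+n _)))

size-none : ∀ {n} (f : Fin n → Bool) → (∀ i → f i ≡ false) → ∥ tabulate f ∥ ≡ 0
size-none {zero}  f none = refl
size-none {suc n} f none with f zero | none zero
... | false | _ = size-none (f ∘ suc) (none ∘ suc)

size-unique : ∀ {n} (f : Fin n → Bool) → (∀ i j → f i ≡ true → f j ≡ true → i ≡ j) → ∥ tabulate f ∥ ≤ 1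
size-unique {zero}  f unique = z≤n
size-unique {suc n} f unique with f zero in f₀
... | false = size-unique (f ∘ suc) (λ i j fi fj → Fin.suc-injective (unique (suc i) (suc j) fi fj))
... | true  = s≤s (ℕ.≤-reflexive (size-none (f ∘ suc) λ i → Bool.¬-not (λ fi → Fin.0≢1+n (unique zero (suc i) f₀ fi))))

length-filterᵇ² : ∀ {n} {A : Set} (f g : A → Bool) (h : Fin n → A) →
                  length (filterᵇ f (filterᵇ g (List.tabulate h))) ≡ ∥ tabulate (λ i → g (h i) ∧ f (h i)) ∥
length-filterᵇ² {zero}  f g h = refl
length-filterᵇ² {suc n} f g h with g (h zero)
... | false = length-filterᵇ² f g (h ∘ suc)
... | true with f (h zero)
...   | false = length-filterᵇ² f g (h ∘ suc)
...   | true  = cong suc (length-filterᵇ² f g (h ∘ suc))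

-- Strands and twists

Strand : Set
Strand = Bool × Bool

∑₂ : (Bool → ℕ) → ℕ
∑₂ f = f false + f true

∑₂-xor : ∀ f b → ∑₂ (λ a → f (a xor b)) ≡ ∑₂ f
∑₂-xor f false = refl
∑₂-xor f true  = ℕ.+-comm (f true) (f false)

∑₂-cong : ∀ {f g : Bool → ℕ} → (∀ b → f b ≡ g b) → ∑₂ f ≡ ∑₂ g
∑₂-cong f≗g = cong₂ _+_ (f≗g false) (f≗g true)

∑ₛ : (Strand → ℕ) → ℕ
∑ₛ f = ∑₂ λ l → ∑₂ λ h → f (h , l)

∑ₛ-cong : ∀ {f g : Strand → ℕ} → (∀ s → f s ≡ g s) → ∑ₛ f ≡ ∑ₛ g
∑ₛ-cong f≗g = ∑₂-cong λ l → ∑₂-cong λ h → f≗g (h , l)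

∑ₛ-+ : ∀ f g → ∑ₛ (λ s → f s + g s) ≡ ∑ₛ f + ∑ₛ g
∑ₛ-+ f g = lemma (f (false , false)) (f (true , false)) (f (false , true)) (f (true , true))
                 (g (false , false)) (g (true , false)) (g (false , true)) (g (true , true))
  where
  lemma : ∀ a b c d a′ b′ c′ d′ → (a + a′ + (b + b′)) + (c + c′ + (d + d′)) ≡ ((a + b) + (c + d)) + ((a′ + b′) + (c′ + d′))
  lemma = ℕ.solve-∀

-- All maps between layers have this form: Alice's matchings have `c` constantly false, Bob's have
-- `d` false. The family is closed under composition.
twist : (Bool → Bool) → Bool → Strand → Strand
twist c d (h , l) = h xor c l , l xor d

-- For each fixed `l` the flip of `h` permutes the inner sum; the flip of `l` then permutes the
-- outer one. This is why `∑ₛ` has `l` outside.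
∑ₛ-twist : ∀ f c d → ∑ₛ (f ∘ twist c d) ≡ ∑ₛ f
∑ₛ-twist f c d = trans
  (∑₂-cong λ l → ∑₂-xor (λ h → f (h , l xor d)) (c l))
  (∑₂-xor (λ l → ∑₂ λ h → f (h , l)) d)

xor-cancelʳ : ∀ a b → (a xor b) xor b ≡ a
xor-cancelʳ a b = trans (xor-assoc a b b) (trans (cong (a xor_) (xor-same b)) (xor-identityʳ a))

untwist : (Bool → Bool) → Bool → Strand → Strand
untwist c d (h , l) = h xor c (l xor d) , l xor d

untwist-twist : ∀ c d s → untwist c d (twist c d s) ≡ s
untwist-twist c d (h , l) rewrite xor-cancelʳ l d = cong (_, l) (xor-cancelʳ h (c l))

twist-untwist : ∀ c d s → twist c d (untwist c d s) ≡ s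
twist-untwist c d (h , l) = cong₂ _,_ (xor-cancelʳ h (c (l xor d))) (xor-cancelʳ l d)

twist-injective : ∀ c d {s t} → twist c d s ≡ twist c d t → s ≡ t
twist-injective c d {s} {t} eq = trans (sym (untwist-twist c d s)) (trans (cong (untwist c d) eq) (untwist-twist c d t))

-- Alice has two layers so that the edges depending on her bits have both ends among her vertices;
-- every other edge has an end in `bob`.
data Layer : Set where
  bob alice alice′ : Layer

Vertex : ℕ → Set
Vertex m = Fin (suc m) × Layer × Strand

layerIndex : Layer → Fin 3
layerIndex bob    = zero
layerIndex alice  = suc zero
layerIndex alice′ = suc (suc zero)

bitIndex : Bool → Fin 2
bitIndex false = zero
bitIndex true  = suc zero

siteIndex : Layer × Strand → Fin 12
siteIndex (ℓ , h , l) = combine (layerIndex ℓ) (combine (bitIndex l) (bitIndex h))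

site : Fin 12 → Layer × Strand
site i = lookup (Vec.map (λ (ℓ , l , h) → ℓ , h , l)
  (allPairs (bob ∷ alice ∷ alice′ ∷ []) (allPairs (false ∷ true ∷ []) (false ∷ true ∷ [])))) i

siteIndex-site : ∀ i → siteIndex (site i) ≡ i
siteIndex-site = from-yes (Fin.all? λ i → siteIndex (site i) Fin.≟ i)

site-siteIndex : ∀ s → site (siteIndex s) ≡ s
site-siteIndex (bob    , false , false) = refl
site-siteIndex (bob    , false , true)  = refl
site-siteIndex (bob    , true  , false) = refl
site-siteIndex (bob    , true  , true)  = refl
site-siteIndex (alice  , false , false) = refl
site-siteIndex (alice  , false , true)  = refl
site-siteIndex (alice  , true  , false) = refl
site-siteIndex (alice  , true  , true)  = refl
site-siteIndex (alice′ , false , false) = refl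
site-siteIndex (alice′ , false , true)  = refl
site-siteIndex (alice′ , true  , false) = refl
site-siteIndex (alice′ , true  , true)  = refl

-- There are `m` periods for the bits of the two vectors and one more which, for `x` vanishing at 0
-- and `suc m`, returns the second bit of every strand to its start. Each period has three layers of
-- four strands.
#V : ℕ → ℕ
#V m = suc m * 12

encode : ∀ {m} → Vertex m → Fin (#V m)
encode (j , s) = combine j (siteIndex s)

decode : ∀ {m} → Fin (#V m) → Vertex m
decode i = let j , k = remQuot 12 i in j , site k

decode-encode : ∀ {m} (v : Vertex m) → decode (encode v) ≡ v
decode-encode (j , s) = trans (cong (λ (j , k) → j , site k) (Fin.remQuot-combine j (siteIndex s))) (cong (j ,_) (site-siteIndex s))

encode-decode : ∀ {m} (i : Fin (#V m)) → encode {m} (decode i) ≡ i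
encode-decode {m} i = trans (cong (combine (proj₁ (remQuot {suc m} 12 i))) (siteIndex-site (proj₂ (remQuot {suc m} 12 i)))) (Fin.combine-remQuot {suc m} 12 i)

∑ᵥ : ∀ {m} → (Vertex m → ℕ) → ℕ
∑ᵥ f = sum λ j → ∑ₛ λ s → f (j , bob , s) + f (j , alice , s) + f (j , alice′ , s)

sum-12 : ∀ (f : Fin 12 → ℕ) → sum f ≡ ∑ₛ λ s → f (siteIndex (bob , s)) + f (siteIndex (alice , s)) + f (siteIndex (alice′ , s))
sum-12 f = begin
  sum f                                           ≡⟨ sum-combine 3 {4} f ⟩
  g bob + (g alice + (g alice′ + 0))              ≡⟨ cong (λ t → g bob + (g alice + t)) (ℕ.+-identityʳ (g alice′)) ⟩
  g bob + (g alice + g alice′)                    ≡⟨ ℕ.+-assoc (g bob) (g alice) (g alice′) ⟨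
  g bob + g alice + g alice′                      ≡⟨ cong₂ _+_ (cong₂ _+_ (four bob) (four alice)) (four alice′) ⟩
  ∑ₛ (F bob) + ∑ₛ (F alice) + ∑ₛ (F alice′)       ≡⟨ cong (_+ ∑ₛ (F alice′)) (∑ₛ-+ (F bob) (F alice)) ⟨
  ∑ₛ (λ s → F bob s + F alice s) + ∑ₛ (F alice′)  ≡⟨ ∑ₛ-+ (λ s → F bob s + F alice s) (F alice′) ⟨
  ∑ₛ (λ s → F bob s + F alice s + F alice′ s)     ∎
  where
  open ≡-Reasoning
  F : Layer → Strand → ℕ
  F ℓ s = f (siteIndex (ℓ , s))
  g : Layer → ℕ
  g ℓ = sum {4} λ k → f (combine (layerIndex ℓ) k)
  four : ∀ ℓ → g ℓ ≡ ∑ₛ (F ℓ)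
  four ℓ = lemma (F ℓ (false , false)) (F ℓ (true , false)) (F ℓ (false , true)) (F ℓ (true , true))
    where
    lemma : ∀ a b c d → a + (b + (c + (d + 0))) ≡ (a + b) + (c + d)
    lemma = ℕ.solve-∀

size≡∑ᵥ : ∀ {m} (f : Fin (#V m) → Bool) → ∥ tabulate f ∥ ≡ ∑ᵥ {m} (bit ∘ f ∘ encode)
size≡∑ᵥ {m} f = trans (size≡sum f) (trans (sum-combine (suc m) (bit ∘ f))
  (sum-cong-≗ {suc m} λ j → sum-12 (λ k → bit (f (combine j k)))))

_≟ₛ_ : DecidableEquality Strand
_≟ₛ_ = ≡-dec Bool._≟_ Bool._≟_

-- Period j has the layers bob, alice, alice′, in this order.  The argument x is offset
-- by one: x 0 precedes the first bit of Alice, and x j ⊕ x (j + 1) is the change of the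
-- second bit in period j.  The last components of the first two clauses isolate the
-- vertices (0 , bob , s) with s ≠ (0 , 0), and cut the edge into (m , alice′ , (1 , 0)).
Next : ∀ {m} (x y : ℕ → Bool) → Vertex m → Vertex m → Set
Next     x y (j , bob    , s) (k , alice  , t) = j ≡ k × t ≡ s × (j ≡ zero → s ≡ (false , false))
Next {m} x y (j , alice  , s) (k , alice′ , t) =
  j ≡ k × t ≡ twist (const false) (x (toℕ j) xor x (suc (toℕ j))) s × (toℕ j ≡ m → t ≢ (true , false))
Next     x y (j , alice′ , s) (k , bob    , t) = toℕ k ≡ suc (toℕ j) × t ≡ twist (y (toℕ j) ∧_) false s
Next     x y _                _                = ⊥

next? : ∀ {m} x y (u v : Vertex m) → Dec (Next x y u v)
next? x y (j , bob    , s) (k , alice  , t) = (j Fin.≟ k) ×-dec (t ≟ₛ s) ×-dec ((j Fin.≟ zero) →-dec (s ≟ₛ (false , false)))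
next? {m} x y (j , alice  , s) (k , alice′ , t) =
  (j Fin.≟ k) ×-dec (t ≟ₛ twist (const false) (x (toℕ j) xor x (suc (toℕ j))) s) ×-dec ((toℕ j ℕ.≟ m) →-dec ¬? (t ≟ₛ (true , false)))
next? x y (j , alice′ , s) (k , bob    , t) = (toℕ k ℕ.≟ suc (toℕ j)) ×-dec (t ≟ₛ twist (y (toℕ j) ∧_) false s)
next? x y (j , bob    , s) (k , bob    , t) = no λ ()
next? x y (j , bob    , s) (k , alice′ , t) = no λ ()
next? x y (j , alice  , s) (k , bob    , t) = no λ ()
next? x y (j , alice  , s) (k , alice  , t) = no λ ()
next? x y (j , alice′ , s) (k , alice  , t) = no λ ()
next? x y (j , alice′ , s) (k , alice′ , t) = no λ ()

adjacent : ∀ {m} (x y : ℕ → Bool) → Vertex m → Vertex m → Bool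
adjacent x y u v = does (next? x y u v) ∨ does (next? x y v u)

next-irreflexive : ∀ {m} x y (v : Vertex m) → does (next? x y v v) ≡ false
next-irreflexive x y (j , bob    , s) = refl
next-irreflexive x y (j , alice  , s) = refl
next-irreflexive x y (j , alice′ , s) = refl

strands : ∀ m (x y : ℕ → Bool) → Graph (Fin (#V m))
strands m x y = record
  { adj         = λ u v → adjacent {m} x y (decode u) (decode v)
  ; symmetric   = λ u v → ∨-comm (does (next? {m} x y (decode u) (decode v))) _
  ; irreflexive = λ v → cong₂ _∨_ (next-irreflexive {m} x y (decode v)) (next-irreflexive {m} x y (decode v))
  }

-- The strand that starts at (h , l) passes through (h ⊕ parity j l , l ⊕ x j) in the
-- layers bob and alice of period j.
parity : (x y : ℕ → Bool) → ℕ → Bool → Bool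
parity x y zero    l = false
parity x y (suc j) l = parity x y j l xor (y j ∧ (l xor x (suc j)))

-- The flip of the second bit relative to the start. It advances in `alice′` because Alice's
-- matching lies between `alice` and `alice′`.
shift : (ℕ → Bool) → Layer → ℕ → Bool
shift x bob    j = x j
shift x alice  j = x j
shift x alice′ j = x (suc j)

trace untrace : ∀ {m} (x y : ℕ → Bool) → Vertex m → Vertex m
trace   x y (j , ℓ , s) = j , ℓ , twist   (parity x y (toℕ j)) (shift x ℓ (toℕ j)) s
untrace x y (j , ℓ , s) = j , ℓ , untwist (parity x y (toℕ j)) (shift x ℓ (toℕ j)) s

trace-untrace : ∀ {m} x y (v : Vertex m) → trace x y (untrace x y v) ≡ v
trace-untrace x y (j , ℓ , s) = cong (λ t → j , ℓ , t) (twist-untwist (parity x y (toℕ j)) (shift x ℓ (toℕ j)) s)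

untrace-trace : ∀ {m} x y (v : Vertex m) → untrace x y (trace x y v) ≡ v
untrace-trace x y (j , ℓ , s) = cong (λ t → j , ℓ , t) (untwist-twist (parity x y (toℕ j)) (shift x ℓ (toℕ j)) s)

∑ᵥ-trace : ∀ {m} x y (f : Vertex m → ℕ) → ∑ᵥ (f ∘ trace x y) ≡ ∑ᵥ f
∑ᵥ-trace x y f = sum-cong-≗ λ j → begin
  ∑ₛ (λ s → F′ bob j s + F′ alice j s + F′ alice′ j s)  ≡⟨ split (F′ bob j) (F′ alice j) (F′ alice′ j) ⟩
  ∑ₛ (F′ bob j) + ∑ₛ (F′ alice j) + ∑ₛ (F′ alice′ j)    ≡⟨ cong₂ _+_ (cong₂ _+_ (layer bob j) (layer alice j)) (layer alice′ j) ⟩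
  ∑ₛ (F bob j) + ∑ₛ (F alice j) + ∑ₛ (F alice′ j)       ≡⟨ split (F bob j) (F alice j) (F alice′ j) ⟨
  ∑ₛ (λ s → F bob j s + F alice j s + F alice′ j s)     ∎
  where
  open ≡-Reasoning
  F F′ : Layer → Fin _ → Strand → ℕ
  F ℓ j s = f (j , ℓ , s)
  F′ ℓ j s = f (trace x y (j , ℓ , s))
  layer : ∀ ℓ j → ∑ₛ (F′ ℓ j) ≡ ∑ₛ (F ℓ j)
  layer ℓ j = ∑ₛ-twist (F ℓ j) (parity x y (toℕ j)) (shift x ℓ (toℕ j))
  split : ∀ f g h → ∑ₛ (λ s → f s + g s + h s) ≡ ∑ₛ f + ∑ₛ g + ∑ₛ h
  split f g h = trans (∑ₛ-+ (λ s → f s + g s) h) (cong (_+ ∑ₛ h) (∑ₛ-+ f g))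

column : ∀ {m} → (Vertex m → ℕ) → Strand → ℕ
column f s = sum λ j → f (j , bob , s) + f (j , alice , s) + f (j , alice′ , s)

∑ᵥ-columns : ∀ {m} (f : Vertex m → ℕ) → ∑ᵥ f ≡ ∑ₛ (column f)
∑ᵥ-columns f = go (λ j s → f (j , bob , s) + f (j , alice , s) + f (j , alice′ , s))
  where
  go : ∀ {n} (g : Fin n → Strand → ℕ) → sum (λ j → ∑ₛ (g j)) ≡ ∑ₛ (λ s → sum (λ j → g j s))
  go {zero}  g = refl
  go {suc n} g = trans (cong (λ t → ∑ₛ (g zero) + t) (go (g ∘ suc))) (sym (∑ₛ-+ (g zero) (λ s → sum (λ j → g (suc j) s))))

-- The edges in the coordinates of trace, which name every vertex by the start of its
-- strand; they depend on x and y only through p = parity m 0.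
PathNext : ∀ {m} → Bool → Vertex m → Vertex m → Set
PathNext     p (j , bob    , s) (k , alice  , t) = j ≡ k × t ≡ s × (j ≡ zero → s ≡ (false , false))
PathNext {m} p (j , alice  , s) (k , alice′ , t) = j ≡ k × t ≡ s × (toℕ j ≡ m → s ≢ (not p , false))
PathNext     p (j , alice′ , s) (k , bob    , t) = toℕ k ≡ suc (toℕ j) × t ≡ s
PathNext     p _                _                = ⊥

-- Straightening the strands

twist-identity : ∀ {c d} → (∀ l → c l ≡ false) → d ≡ false → ∀ s → twist c d s ≡ s
twist-identity c≡0 refl (h , l) = cong₂ _,_ (trans (cong (h xor_) (c≡0 l)) (xor-identityʳ h)) (xor-identityʳ l)

twist-∘ : ∀ c d c′ d′ s → twist c′ d′ (twist c d s) ≡ twist (λ l → c l xor c′ (l xor d)) (d xor d′) s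
twist-∘ c d c′ d′ (h , l) = cong₂ _,_ (xor-assoc h (c l) (c′ (l xor d))) (xor-assoc l d d′)

twist-cong : ∀ {c c′ d d′} → (∀ l → c l ≡ c′ l) → d ≡ d′ → ∀ s → twist c d s ≡ twist c′ d′ s
twist-cong c≗c′ refl (h , l) = cong (λ b → h xor b , l xor _) (c≗c′ l)

module _ {m : ℕ} (x y : ℕ → Bool) (x₀ : x 0 ≡ false) (xₘ : x (suc m) ≡ false) where

  private
    c : ℕ → Bool → Bool
    c = parity x y

    p : Bool
    p = c m false

  alice-step : ∀ j s → twist (const false) (x j xor x (suc j)) (twist (c j) (x j) s) ≡ twist (c j) (x (suc j)) s
  alice-step j s = trans (twist-∘ (c j) (x j) (const false) (x j xor x (suc j)) s)
    (twist-cong (λ l → xor-identityʳ (c j l))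
      (trans (sym (xor-assoc (x j) (x j) (x (suc j)))) (cong (_xor x (suc j)) (xor-same (x j)))) s)

  bob-step : ∀ j s → twist (y j ∧_) false (twist (c j) (x (suc j)) s) ≡ twist (c (suc j)) (x (suc j)) s
  bob-step j s = trans (twist-∘ (c j) (x (suc j)) (y j ∧_) false s)
    (twist-cong {c′ = c (suc j)} (λ l → refl) (xor-identityʳ (x (suc j))) s)

  entry : ∀ s → twist (c 0) (x 0) s ≡ s
  entry = twist-identity (λ _ → refl) x₀

  -- The cut at the final vertex `(true , false)` belongs to the strand that starts at
  -- `(not p , false)`: to the extended strand `(false , false)` if `p` is true, to `(true , false)`
  -- otherwise.
  exit : twist (c m) (x (suc m)) (not p , false) ≡ (true , false)
  exit rewrite xₘ with p
  ... | false = refl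
  ... | true  = refl

  -- By `alice-step` and `bob-step` the matchings join vertices of the same strand, so injectivity
  -- of the twists gives equal starts; `entry` and `exit` translate the conditions in the first and
  -- last period.
  next⇒path : ∀ u v → Next {m} x y (trace x y u) (trace x y v) → PathNext p u v
  next⇒path (j , bob , s) (k , alice , t) (refl , t≡s , first) =
    refl , twist-injective (c (toℕ j)) (x (toℕ j)) t≡s , λ { refl → trans (sym (entry s)) (first refl) }
  next⇒path (j , alice , s) (k , alice′ , t) (refl , t≡s , last) =
    refl , t≡s′ , λ { j≡m refl → last j≡m (trans (cong (twist (c (toℕ j)) (x (suc (toℕ j)))) t≡s′)
      (subst (λ i → twist (c i) (x (suc i)) (not p , false) ≡ _) (sym j≡m) exit)) }
    where
    t≡s′ : t ≡ s
    t≡s′ = twist-injective (c (toℕ j)) (x (suc (toℕ j))) (trans t≡s (alice-step (toℕ j) s))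
  next⇒path (j , alice′ , s) (k , bob , t) (k≡1+j , t≡s) =
    k≡1+j , twist-injective (c (suc (toℕ j))) (x (suc (toℕ j)))
      (trans (cong (λ i → twist (c i) (x i) t) (sym k≡1+j)) (trans t≡s (bob-step (toℕ j) s)))

  path⇒next : ∀ u v → PathNext p u v → Next {m} x y (trace x y u) (trace x y v)
  path⇒next (j , bob , s) (k , alice , t) (refl , refl , first) =
    refl , refl , λ { refl → trans (entry s) (first refl) }
  path⇒next (j , alice , s) (k , alice′ , t) (refl , refl , last) =
    refl , sym (alice-step (toℕ j) s) , λ j≡m t≡10 → last j≡m (twist-injective (c (toℕ j)) (x (suc (toℕ j)))
      (trans t≡10 (sym (subst (λ i → twist (c i) (x (suc i)) (not p , false) ≡ _) (sym j≡m) exit))))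
  path⇒next (j , alice′ , s) (k , bob , t) (k≡1+j , refl) =
    k≡1+j , trans (cong (λ i → twist (c i) (x i) t) k≡1+j) (sym (bob-step (toℕ j) s))

does⇒ : ∀ {P : Set} (P? : Dec P) → does P? ≡ true → P
does⇒ (yes p) _ = p

Linked : ∀ {m} → Bool → Vertex m → Vertex m → Set
Linked p v w = PathNext p v w ⊎ PathNext p w v

pathNext-irreflexive : ∀ {m} p (v : Vertex m) → ¬ PathNext p v v
pathNext-irreflexive p (_ , bob    , _) ()
pathNext-irreflexive p (_ , alice  , _) ()
pathNext-irreflexive p (_ , alice′ , _) ()

pathNext-functional : ∀ {m} p (u v w : Vertex m) → PathNext p u v → PathNext p u w → v ≡ w
pathNext-functional p (j , bob , s) (_ , alice , _) (_ , alice , _) (refl , refl , _) (refl , refl , _) = refl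
pathNext-functional p (j , alice , s) (_ , alice′ , _) (_ , alice′ , _) (refl , refl , _) (refl , refl , _) = refl
pathNext-functional p (j , alice′ , s) (k , bob , _) (l , bob , _) (k≡1+j , refl) (l≡1+j , refl) =
  cong (λ i → i , bob , s) (Fin.toℕ-injective (trans k≡1+j (sym l≡1+j)))

pathNext-injective : ∀ {m} p (u v w : Vertex m) → PathNext p v u → PathNext p w u → v ≡ w
pathNext-injective p (j , alice , s) (_ , bob , _) (_ , bob , _) (refl , refl , _) (refl , refl , _) = refl
pathNext-injective p (j , alice′ , s) (_ , alice , _) (_ , alice , _) (refl , refl , _) (refl , refl , _) = refl
pathNext-injective p (j , bob , s) (k , alice′ , _) (l , alice′ , _) (j≡1+k , refl) (j≡1+l , refl) =
  cong (λ i → i , alice′ , s) (Fin.toℕ-injective (ℕ.suc-injective (trans (sym j≡1+k) j≡1+l)))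

Δ≤ : ∀ {n} (G : Graph (Fin n)) {d} → (∀ i → degree G i ≤ d) → Δ G ≤ d
Δ≤ {n} G {d} degree≤d = max≤v⁺ z≤n (All.map⁺ {f = degree G} (All.universal degree≤d (allFin n)))

-- Deletion sets of the strand graph

isMain : Strand → Bool
isMain (false , false) = true
isMain (false , true)  = false
isMain (true  , _)     = false

isMain⇒ : ∀ s → isMain s ≡ true → s ≡ (false , false)
isMain⇒ (false , false) _ = refl

¬≡ᵇ⇒≡ : ∀ i j → not (i ≡ᵇ j) ≡ false → i ≡ j
¬≡ᵇ⇒≡ zero    zero    _  = refl
¬≡ᵇ⇒≡ (suc i) (suc j) eq = cong suc (¬≡ᵇ⇒≡ i j eq)

module _ {m : ℕ} where

  -- Every third vertex of each path; for p = 1 the remaining components are edges and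
  -- isolated vertices.
  deleted : Vertex m → Bool
  deleted (j , bob    , s) = not (isMain s) ∧ not (toℕ j ≡ᵇ 0)
  deleted (j , alice  , s) = false
  deleted (j , alice′ , s) = isMain s ∧ not (toℕ j ≡ᵇ m)

  -- A label for each remaining component: on the main strand the edges from `bob` to `alice`
  -- survive, on the other strands those from `alice` to `alice′`.
  representative : Vertex m → Vertex m
  representative (j , bob    , s) = j , bob , s
  representative (j , alice  , s) = if isMain s then (j , bob , s) else (j , alice , s)
  representative (j , alice′ , s) = if isMain s then (j , alice′ , s) else (j , alice , s)

  next⇒same : ∀ v w → deleted v ≡ false → deleted w ≡ false → PathNext true v w → representative v ≡ representative w
  next⇒same (j , bob , s) (_ , alice , _) v∉ w∉ (refl , refl , first) with isMain s in main
  ... | true  = refl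
  -- Off the main strand only the `bob` vertex of period 0 is kept, and it is isolated.
  ... | false with refl ← first (Fin.toℕ-injective (¬≡ᵇ⇒≡ (toℕ j) 0 v∉)) with () ← main
  next⇒same (j , alice , s) (_ , alice′ , _) v∉ w∉ (refl , refl , last) with isMain s in main
  -- On the main strand only the last `alice′` vertex is kept, and the cut isolates it.
  ... | true  = contradiction (isMain⇒ s main) (last (¬≡ᵇ⇒≡ (toℕ j) m w∉))
  ... | false = refl
  next⇒same (j , alice′ , s) (k , bob , _) v∉ w∉ (k≡1+j , refl) with isMain s
  ... | true  = contradiction (trans k≡1+j (cong suc (¬≡ᵇ⇒≡ (toℕ j) m v∉))) (ℕ.<⇒≢ (Fin.toℕ<n k))
  ... | false = contradiction (trans (sym k≡1+j) (¬≡ᵇ⇒≡ (toℕ k) 0 w∉)) λ ()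

  same⇒linked : ∀ v w → v ≢ w → deleted v ≡ false → deleted w ≡ false → representative v ≡ representative w → Linked true v w
  same⇒linked (j , bob , s) (k , bob , t) v≢w v∉ w∉ same = contradiction same v≢w
  same⇒linked (j , bob , s) (k , alice , t) v≢w v∉ w∉ same with isMain t in main
  same⇒linked (j , bob , s) (k , alice , t) v≢w v∉ w∉ refl | true = inj₁ (refl , refl , λ _ → isMain⇒ s main)
  same⇒linked (j , bob , s) (k , alice , t) v≢w v∉ w∉ () | false
  same⇒linked (j , bob , s) (k , alice′ , t) v≢w v∉ w∉ same with isMain t
  same⇒linked (j , bob , s) (k , alice′ , t) v≢w v∉ w∉ () | true
  same⇒linked (j , bob , s) (k , alice′ , t) v≢w v∉ w∉ () | false
  same⇒linked (j , alice , s) (k , alice , t) v≢w v∉ w∉ same with isMain s | isMain t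
  same⇒linked (j , alice , s) (k , alice , t) v≢w v∉ w∉ refl | true  | true  = contradiction refl v≢w
  same⇒linked (j , alice , s) (k , alice , t) v≢w v∉ w∉ refl | false | false = contradiction refl v≢w
  same⇒linked (j , alice , s) (k , alice , t) v≢w v∉ w∉ ()   | true  | false
  same⇒linked (j , alice , s) (k , alice , t) v≢w v∉ w∉ ()   | false | true
  same⇒linked (j , alice , s) (k , alice′ , t) v≢w v∉ w∉ same with isMain s in main | isMain t
  same⇒linked (j , alice , s) (k , alice′ , t) v≢w v∉ w∉ refl | false | false =
    inj₁ (refl , refl , λ { _ refl → contradiction main λ () })
  same⇒linked (j , alice , s) (k , alice′ , t) v≢w v∉ w∉ ()   | true  | true
  same⇒linked (j , alice , s) (k , alice′ , t) v≢w v∉ w∉ ()   | false | true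
  same⇒linked (j , alice , s) (k , alice′ , t) v≢w v∉ w∉ ()   | true  | false
  same⇒linked (j , alice′ , s) (k , alice′ , t) v≢w v∉ w∉ same with isMain s | isMain t
  same⇒linked (j , alice′ , s) (k , alice′ , t) v≢w v∉ w∉ refl | true  | true  = contradiction refl v≢w
  same⇒linked (j , alice′ , s) (k , alice′ , t) v≢w v∉ w∉ refl | false | false = contradiction refl v≢w
  same⇒linked (j , alice′ , s) (k , alice′ , t) v≢w v∉ w∉ ()   | true  | false
  same⇒linked (j , alice′ , s) (k , alice′ , t) v≢w v∉ w∉ ()   | false | true
  same⇒linked v@(_ , alice  , _) w@(_ , bob   , _) v≢w v∉ w∉ same = Sum.swap (same⇒linked w v (v≢w ∘ sym) w∉ v∉ (sym same))
  same⇒linked v@(_ , alice′ , _) w@(_ , bob   , _) v≢w v∉ w∉ same = Sum.swap (same⇒linked w v (v≢w ∘ sym) w∉ v∉ (sym same))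
  same⇒linked v@(_ , alice′ , _) w@(_ , alice , _) v≢w v∉ w∉ same = Sum.swap (same⇒linked w v (v≢w ∘ sym) w∉ v∉ (sym same))

lookup-∉ : ∀ {n} {X : Subset n} {i} → lookup X i ≡ false → i ∉ X
lookup-∉ {X = X} i∉X i∈X with () ← trans (sym (Vec.[]=⇒lookup i∈X)) i∉X

∉-lookup : ∀ {n} {X : Subset n} {i} → i ∉ X → lookup X i ≡ false
∉-lookup {X = X} {i} i∉X = Bool.¬-not λ i∈X → i∉X (Vec.lookup⇒[]= i X i∈X)

sum-one : ∀ n → sum {n} (λ _ → 1) ≡ n
sum-one zero    = refl
sum-one (suc n) = cong suc (sum-one n)

sum-≢last : ∀ m → sum {suc m} (λ j → bit (not (toℕ j ≡ᵇ m))) ≡ m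
sum-≢last zero    = refl
sum-≢last (suc m) = cong suc (sum-≢last m)

column-deleted : ∀ m s → column {m} (bit ∘ deleted) s ≡ m
column-deleted m (false , false) = sum-≢last m
column-deleted m (false , true)  = sum-one m
column-deleted m (true  , _)     = sum-one m

sum-≥ : ∀ {n} (g : Fin n → ℕ) → (∀ j → 1 ≤ g j) → n ≤ sum g
sum-≥ {zero}  g g≥1 = z≤n
sum-≥ {suc n} g g≥1 = ℕ.+-mono-≤ (g≥1 zero) (sum-≥ (g ∘ suc) (g≥1 ∘ suc))

-- The triples `a j`, `a′ j`, `b (suc j)` straddle two periods, are disjoint and leave out `b zero`.
-- This term stays on the left because in the induction hypothesis it is the `b (suc zero)` used by
-- the first triple.
sum-shifted-≥ : ∀ {m} (b a a′ : Fin (suc m) → ℕ) → (∀ j → 1 ≤ a (inject₁ j) + a′ (inject₁ j) + b (suc j)) →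
                b zero + m ≤ sum (λ j → b j + a j + a′ j)
sum-shifted-≥ {zero}  b a a′ hit = ℕ.≤-trans (ℕ.≤-trans (ℕ.≤-reflexive (ℕ.+-identityʳ (b zero)))
  (ℕ.≤-trans (ℕ.m≤m+n (b zero) (a zero)) (ℕ.m≤m+n _ (a′ zero)))) (ℕ.m≤m+n _ 0)
sum-shifted-≥ {suc m} b a a′ hit = begin
  b zero + suc m                                  ≡⟨ ℕ.+-suc (b zero) m ⟩
  1 + (b zero + m)                                ≤⟨ ℕ.+-monoˡ-≤ (b zero + m) (hit zero) ⟩
  a zero + a′ zero + b (suc zero) + (b zero + m)  ≡⟨ lemma (a zero) (a′ zero) (b (suc zero)) (b zero) m ⟩
  b zero + a zero + a′ zero + (b (suc zero) + m)  ≤⟨ ℕ.+-monoʳ-≤ (b zero + a zero + a′ zero) (sum-shifted-≥ (b ∘ suc) (a ∘ suc) (a′ ∘ suc) (hit ∘ suc)) ⟩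
  sum (λ j → b j + a j + a′ j)                    ∎
  where
  open ℕ.≤-Reasoning
  lemma : ∀ a a′ b₁ b n → a + a′ + b₁ + (b + n) ≡ b + a + a′ + (b₁ + n)
  lemma = ℕ.solve-∀

module _ {m : ℕ} (x y : ℕ → Bool) (x₀ : x 0 ≡ false) (xₘ : x (suc m) ≡ false) where

  position : Fin (#V m) → Vertex m
  position i = untrace x y (decode i)

  at : Vertex m → Fin (#V m)
  at v = encode (trace x y v)

  at-position : ∀ i → at (position i) ≡ i
  at-position i = trans (cong (encode {m}) (trace-untrace x y (decode i))) (encode-decode {m} i)

  position-at : ∀ v → position (at v) ≡ v
  position-at v = trans (cong (untrace {m} x y) (decode-encode {m} (trace x y v))) (untrace-trace x y v)

  position-injective : ∀ {i j} → position i ≡ position j → i ≡ j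
  position-injective {i} {j} eq = trans (sym (at-position i)) (trans (cong at eq) (at-position j))

  at-injective : ∀ {v w} → at v ≡ at w → v ≡ w
  at-injective {v} {w} eq = trans (sym (position-at v)) (trans (cong position eq) (position-at w))

  module _ {p : Bool} (pₘ : parity x y m false ≡ p) where

    next⇒pathNext : ∀ i j → does (next? {m} x y (decode i) (decode j)) ≡ true → PathNext p (position i) (position j)
    next⇒pathNext i j next = subst (λ p → PathNext p _ _) pₘ (next⇒path x y x₀ xₘ (position i) (position j)
      (subst₂ (Next x y) (sym (trace-untrace x y (decode i))) (sym (trace-untrace x y (decode j)))
        (does⇒ (next? x y (decode i) (decode j)) next)))

    adj⇒linked : ∀ i j → adj (strands m x y) i j ≡ true → Linked p (position i) (position j)
    adj⇒linked i j ij with does (next? {m} x y (decode i) (decode j)) in next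
    ... | true  = inj₁ (next⇒pathNext i j next)
    ... | false = inj₂ (next⇒pathNext j i ij)

    pathNext⇒next : ∀ v w → PathNext p v w → does (next? {m} x y (decode (at v)) (decode (at w))) ≡ true
    pathNext⇒next v w v→w = dec-true (next? x y (decode (at v)) (decode (at w)))
      (subst₂ (Next x y) (sym (decode-encode (trace x y v))) (sym (decode-encode (trace x y w)))
        (path⇒next x y x₀ xₘ v w (subst (λ p → PathNext p v w) (sym pₘ) v→w)))

    linked⇒adj : ∀ v w → Linked p v w → adj (strands m x y) (at v) (at w) ≡ true
    linked⇒adj v w (inj₁ v→w) = cong (_∨ does (next? {m} x y (decode (at w)) (decode (at v)))) (pathNext⇒next v w v→w)
    linked⇒adj v w (inj₂ w→v) = trans (cong (does (next? {m} x y (decode (at v)) (decode (at w))) ∨_) (pathNext⇒next w v w→v)) (Bool.∨-zeroʳ _)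

  out in′ : Fin (#V m) → Fin (#V m) → Bool
  out i j = does (next? {m} x y (decode i) (decode j))
  in′ i j = does (next? {m} x y (decode j) (decode i))

  out≤1 : ∀ i → ∥ tabulate (out i) ∥ ≤ 1
  out≤1 i = size-unique (out i) λ j k ij ik → position-injective
    (pathNext-functional (parity x y m false) (position i) (position j) (position k) (next⇒pathNext refl i j ij) (next⇒pathNext refl i k ik))

  in≤1 : ∀ i → ∥ tabulate (in′ i) ∥ ≤ 1
  in≤1 i = size-unique (in′ i) λ j k ji ki → position-injective
    (pathNext-injective (parity x y m false) (position i) (position j) (position k) (next⇒pathNext refl j i ji) (next⇒pathNext refl k i ki))

  degree≤2 : ∀ i → degree (strands m x y) i ≤ 2
  degree≤2 i = ℕ.≤-trans (size-∨ (out i) (in′ i)) (ℕ.+-mono-≤ (out≤1 i) (in≤1 i))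

  Δ≤2 : Δ (strands m x y) ≤ 2
  Δ≤2 = Δ≤ (strands m x y) degree≤2

  -- Counted in strand coordinates, the size of a set splits over the four strands, which can then
  -- be treated one by one.
  size≡columns : ∀ (f : Fin (#V m) → Bool) → ∥ tabulate f ∥ ≡ ∑ₛ (column (bit ∘ f ∘ at))
  size≡columns f = begin
    ∥ tabulate f ∥              ≡⟨ size≡∑ᵥ {m} f ⟩
    ∑ᵥ {m} (bit ∘ f ∘ encode)   ≡⟨ ∑ᵥ-trace {m} x y (bit ∘ f ∘ encode {m}) ⟨
    ∑ᵥ {m} (bit ∘ f ∘ at)       ≡⟨ ∑ᵥ-columns {m} (bit ∘ f ∘ at) ⟩
    ∑ₛ (column (bit ∘ f ∘ at))  ∎
    where open ≡-Reasoning

  -- The cut shortens the extended strand, so apart from isolated vertices there are four paths of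
  -- `3 * m + 2` vertices, and `m` deletions in each of them leave only edges.
  odd⇒deletable : parity x y m false ≡ true → ClusterVertexDeletion (strands m x y) (4 * m)
  odd⇒deletable pₘ = X , ∣X∣≤4m , clique , clique-spec
    where
    X : Subset (#V m)
    X = tabulate (deleted ∘ position)

    ∣X∣≤4m : ∥ X ∥ ≤ 4 * m
    ∣X∣≤4m = ℕ.≤-reflexive (begin
      ∥ X ∥                                        ≡⟨ size≡columns (deleted ∘ position) ⟩
      ∑ₛ (column (bit ∘ deleted ∘ position ∘ at))  ≡⟨ ∑ₛ-cong (λ s → sum-cong-≗ {suc m} λ j → cong₂ _+_ (cong₂ _+_
                                                          (back (j , bob , s)) (back (j , alice , s))) (back (j , alice′ , s))) ⟩
      ∑ₛ (column {m} (bit ∘ deleted))              ≡⟨ ∑ₛ-cong (column-deleted m) ⟩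
      (m + m) + (m + m)                            ≡⟨ lemma m ⟩
      4 * m                                        ∎)
      where
      open ≡-Reasoning
      back : ∀ v → bit (deleted (position (at v))) ≡ bit (deleted v)
      back v = cong (bit ∘ deleted) (position-at v)
      lemma : ∀ a → (a + a) + (a + a) ≡ 4 * a
      lemma = ℕ.solve-∀

    clique : _ → ℕ
    clique (i , _) = toℕ (encode {m} (representative (position i)))

    kept : ∀ {i} → i ∉ X → deleted (position i) ≡ false
    kept {i} i∉X = trans (sym (Vec.lookup∘tabulate (deleted ∘ position) i)) (∉-lookup i∉X)

    clique-spec : ∀ u v → u ≢ v → adj (strands m x y ∖ X) u v ≡ true ⇔ clique u ≡ clique v
    clique-spec (i , i∉X) (j , j∉X) i≢j = mk⇔ to from
      where
      to : adj (strands m x y) i j ≡ true → clique (i , i∉X) ≡ clique (j , j∉X)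
      to ij = cong (toℕ ∘ encode {m})
        (Sum.reduce (Sum.map (next⇒same (position i) (position j) (kept i∉X) (kept j∉X))
                     (λ j→i → sym (next⇒same (position j) (position i) (kept j∉X) (kept i∉X) j→i))
                     (adj⇒linked pₘ i j ij)))
      from : clique (i , i∉X) ≡ clique (j , j∉X) → adj (strands m x y) i j ≡ true
      from same = subst₂ (λ i j → adj (strands m x y) i j ≡ true) (at-position i) (at-position j)
        (linked⇒adj pₘ (position i) (position j) (same⇒linked (position i) (position j)
          (λ eq → i≢j (equal (position-injective eq))) (kept i∉X) (kept j∉X)
          (trans (sym (decode-encode {m} _)) (trans (cong (decode {m}) (Fin.toℕ-injective same)) (decode-encode {m} _)))))
        where
        -- The proofs of `∉` are definitionally equal, so equality of the indices is enough.
        equal : i ≡ j → _≡_ {A = Σ (Fin (#V m)) (_∉ X)} (i , i∉X) (j , j∉X)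
        equal refl = refl

  -- The extended strand keeps its `3 * m + 3` vertices and contains `suc m` disjoint induced P₃,
  -- one in each period. Each other strand contains `m` of them, and a deletion set meets all
  -- `4 * m + 1`.
  even⇒¬deletable : parity x y m false ≡ false → ¬ ClusterVertexDeletion (strands m x y) (4 * m)
  even⇒¬deletable pₘ (X , ∣X∣≤4m , clique , clique-spec) = ℕ.<⇒≱ (begin-strict
      4 * m                    <⟨ ℕ.≤-reflexive (lemma m) ⟩
      (suc m + m) + (m + m)    ≤⟨ ℕ.+-mono-≤ (ℕ.+-mono-≤ main (other (true , false))) (ℕ.+-mono-≤ (other (false , true)) (other (true , true))) ⟩
      ∑ₛ (column f)            ≡⟨ size≡columns (lookup X) ⟨
      ∥ tabulate (lookup X) ∥  ≡⟨ cong ∥_∥ (Vec.tabulate∘lookup X) ⟩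
      ∥ X ∥                    ∎) ∣X∣≤4m
    where
    open ℕ.≤-Reasoning
    lemma : ∀ a → suc (4 * a) ≡ (suc a + a) + (a + a)
    lemma = ℕ.solve-∀

    f : Vertex m → ℕ
    f v = bit (lookup X (at v))

    Kept : Set
    Kept = Σ (Fin (#V m)) (_∉ X)

    kept : ∀ v → lookup X (at v) ≡ false → Kept
    kept v v∉ = at v , lookup-∉ v∉

    linked⇒same : ∀ v w v∉ w∉ → PathNext false v w → clique (kept v v∉) ≡ clique (kept w w∉)
    linked⇒same v w v∉ w∉ v→w = Equivalence.to (clique-spec (kept v v∉) (kept w w∉)
      (λ eq → pathNext-irreflexive false v (subst (PathNext false v) (sym (at-injective (cong proj₁ eq))) v→w)))
      (linked⇒adj pₘ v w (inj₁ v→w))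

    same⇒linked′ : ∀ v w v∉ w∉ → v ≢ w → clique (kept v v∉) ≡ clique (kept w w∉) → Linked false v w
    same⇒linked′ v w v∉ w∉ v≢w same = subst₂ (Linked false) (position-at v) (position-at w)
      (adj⇒linked pₘ (at v) (at w) (Equivalence.from (clique-spec (kept v v∉) (kept w w∉)
        (λ eq → v≢w (at-injective (cong proj₁ eq)))) same))

    -- If none of the three were deleted, the two edges would give `u` and `w` the same clique label
    -- and hence an edge.
    hit : ∀ u v w → PathNext false u v → PathNext false v w → u ≢ w → ¬ Linked false u w → 1 ≤ f u + f v + f w
    hit u v w u→v v→w u≢w ¬uw with lookup X (at u) in u? | lookup X (at v) in v? | lookup X (at w) in w?
    ... | true  | _     | _     = s≤s z≤n
    ... | false | true  | _     = s≤s z≤n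
    ... | false | false | true  = s≤s z≤n
    ... | false | false | false = contradiction
      (same⇒linked′ u w u? w? u≢w (trans (linked⇒same u v u? v? u→v) (linked⇒same v w v? w? v→w))) ¬uw

    main : suc m ≤ column f (false , false)
    main = sum-≥ _ λ j → hit (j , bob , _) (j , alice , _) (j , alice′ , _)
      (refl , refl , λ _ → refl) (refl , refl , λ _ ()) (λ ())
      λ { (inj₁ ()) ; (inj₂ (j≡1+j , _)) → ℕ.1+n≢n (sym j≡1+j) }

    other : ∀ s → m ≤ column f s
    -- The triples run from `alice` to `bob` of the next period and avoid `(zero , bob , s)`, which
    -- is isolated unless `s` is the extended strand.
    other s = ℕ.≤-trans (ℕ.m≤n+m m (f (zero , bob , s)))
      (sum-shifted-≥ (λ j → f (j , bob , s)) (λ j → f (j , alice , s)) (λ j → f (j , alice′ , s)) λ j →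
        hit (inject₁ j , alice , s) (inject₁ j , alice′ , s) (suc j , bob , s)
          -- The period `inject₁ j` lies below `m`, out of reach of the cut in the last period.
          (refl , refl , λ j≡m → contradiction (trans (sym (Fin.toℕ-inject₁ j)) j≡m) (ℕ.<⇒≢ (Fin.toℕ<n j)))
          (cong suc (sym (Fin.toℕ-inject₁ j)) , refl) (λ ())
          λ { (inj₁ ()) ; (inj₂ (j≡1+j , _)) → ℕ.1+n≢n (trans (cong toℕ j≡1+j) (Fin.toℕ-inject₁ j)) })

-- The stream of the strand graph

on : Layer → Layer → Bool
on bob    bob    = true
on alice  alice  = true
on alice′ alice′ = true
on _      _      = false

on⇒≡ : ∀ ℓ ℓ′ → T (on ℓ ℓ′) → ℓ′ ≡ ℓ
on⇒≡ bob    bob    _ = refl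
on⇒≡ alice  alice  _ = refl
on⇒≡ alice′ alice′ _ = refl

-- The layers stand in the order in which `seen` lists them at the end, the latest arrivals first.
layers-↭ : ∀ {A : Set} (layer : A → Layer) xs →
  filterᵇ (on bob ∘ layer) xs ++ filterᵇ (on alice′ ∘ layer) xs ++ filterᵇ (on alice ∘ layer) xs ↭ xs
layers-↭ layer []       = ↭-refl
layers-↭ layer (x ∷ xs) with layer x
... | bob    = prep x (layers-↭ layer xs)
... | alice′ = ↭-trans (↭.shift x (filterᵇ (on bob ∘ layer) xs) _) (prep x (layers-↭ layer xs))
... | alice  = ↭-trans (↭.++⁺ˡ (filterᵇ (on bob ∘ layer) xs) (↭.shift x (filterᵇ (on alice′ ∘ layer) xs) _))
                 (↭-trans (↭.shift x (filterᵇ (on bob ∘ layer) xs) _) (prep x (layers-↭ layer xs)))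

-- Takes the place of the other player's input in edges that do not depend on it.
unset : ℕ → Bool
unset _ = false

layerᵥ : ∀ {m} → Vertex m → Layer
layerᵥ (_ , ℓ , _) = ℓ

module _ {m : ℕ} where

  adjacent-layer : ∀ x y (u v : Vertex m) → layerᵥ u ≡ layerᵥ v → adjacent x y u v ≡ false
  adjacent-layer x y (_ , bob    , _) (_ , bob    , _) _ = refl
  adjacent-layer x y (_ , alice  , _) (_ , alice  , _) _ = refl
  adjacent-layer x y (_ , alice′ , _) (_ , alice′ , _) _ = refl

  adjacent-alice : ∀ x y (u v : Vertex m) → layerᵥ u ≡ alice′ → layerᵥ v ≡ alice →
                   adjacent x unset u v ≡ adjacent x y u v
  adjacent-alice x y (_ , alice′ , _) (_ , alice , _) _ _ = refl

  adjacent-bob : ∀ x y (u v : Vertex m) → layerᵥ u ≡ bob → adjacent unset y u v ≡ adjacent x y u v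
  adjacent-bob x y (_ , bob , _) (_ , bob    , _) _ = refl
  adjacent-bob x y (_ , bob , _) (_ , alice  , _) _ = refl
  adjacent-bob x y (_ , bob , _) (_ , alice′ , _) _ = refl

  back-degree : (ℕ → Bool) → Vertex m → ℕ
  back-degree x v = ∑ᵥ {m} λ u → bit (on alice (layerᵥ u) ∧ adjacent x unset v u)

  -- For each j the strand matched to v is a bijective image of s, so summing over s forgets x.
  back-degree-constant : ∀ x v → layerᵥ v ≡ alice′ → back-degree x v ≡ back-degree unset v
  back-degree-constant x (k , alice′ , t) _ = sum-cong-≗ {suc m} λ j → trans (forget x j) (sym (forget unset j))
    where
    g : Fin (suc m) → Strand → ℕ
    g j s = bit (does (j Fin.≟ k) ∧ (does (t ≟ₛ s) ∧ does ((toℕ j ℕ.≟ m) →-dec ¬? (t ≟ₛ (true , false)))))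
    forget : ∀ x j → ∑ₛ (λ s → bit false + bit (adjacent x unset (k , alice′ , t) (j , alice , s)) + bit false) ≡ ∑ₛ (g j)
    forget x j = trans (∑ₛ-cong {g = g j ∘ twist (const false) _} λ s → ℕ.+-identityʳ _)
      (∑ₛ-twist (g j) (const false) (x (toℕ j) xor x (suc (toℕ j))))

  private
    G : (x y : ℕ → Bool) → Graph (Fin (#V m))
    G = strands m

  layer : Fin (#V m) → Layer
  layer i = layerᵥ {m} (decode i)

  opaque
    exposed : Layer → List (Fin (#V m))
    exposed ℓ = filterᵇ (on ℓ ∘ layer) (allFin (#V m))

    exposed-layer : ∀ ℓ → All (λ i → layer i ≡ ℓ) (exposed ℓ)
    exposed-layer ℓ = All.map (λ {i} → on⇒≡ ℓ (layer i)) (All.all-filter (T? ∘ on ℓ ∘ layer) (allFin (#V m)))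

    exposed-↭ : exposed bob ++ exposed alice′ ++ exposed alice ↭ allFin (#V m)
    exposed-↭ = layers-↭ layer (allFin (#V m))

    length-filterᵇ-exposed : ∀ f ℓ → length (filterᵇ f (exposed ℓ)) ≡ ∥ tabulate (λ j → on ℓ (layer j) ∧ f j) ∥
    length-filterᵇ-exposed f ℓ = length-filterᵇ² f (on ℓ ∘ layer) id

  -- The `alice` vertices bring no edges; the edges between Alice's two layers are revealed with
  -- `alice′`.
  aliceTokens : (ℕ → Bool) → List (VAToken (#V m))
  aliceTokens x = tokens (λ _ → []) (exposed alice) ++ tokens (λ i → filterᵇ (adj (G x unset) i) (exposed alice)) (exposed alice′)

  bobTokens : (ℕ → Bool) → List (VAToken (#V m))
  bobTokens y = tokens (λ i → filterᵇ (adj (G unset y) i) (exposed alice′ ++ exposed alice)) (exposed bob)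

  size-back : ∀ x i → length (filterᵇ (adj (G x unset) i) (exposed alice)) ≡ back-degree x (decode i)
  size-back x i = begin
    length (filterᵇ (adj (G x unset) i) (exposed alice))           ≡⟨ length-filterᵇ-exposed (adj (G x unset) i) alice ⟩
    ∥ tabulate (λ j → on alice (layer j) ∧ adj (G x unset) i j) ∥  ≡⟨ size≡∑ᵥ {m} (λ j → on alice (layer j) ∧ adj (G x unset) i j) ⟩
    ∑ᵥ {m} (λ u → f (decode (encode u)))                           ≡⟨ sum-cong-≗ {suc m} (λ j → ∑ₛ-cong λ s →
                                                                           cong₂ _+_ (cong₂ _+_ (back (j , bob , s)) (back (j , alice , s))) (back (j , alice′ , s))) ⟩
    back-degree x (decode i)                                       ∎
    where
    open ≡-Reasoning
    f : Vertex m → ℕ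
    f u = bit (on alice (layerᵥ u) ∧ adjacent x unset (decode i) u)
    back : ∀ u → f (decode (encode u)) ≡ f u
    back u = cong f (decode-encode u)

  -- This is the common length that lets Bob's tokens begin at a fixed position. The cut in `Next`
  -- is expressed at the `alice′` end, so the number of edges arriving with a vertex is the same for
  -- every `x`.
  length-aliceTokens : ∀ x → length (aliceTokens x) ≡ length (aliceTokens unset)
  length-aliceTokens x = trans (List.length-++ (tokens (λ _ → []) (exposed alice)))
    (trans (cong (λ t → length (tokens {#V m} (λ _ → []) (exposed alice)) + t)
      (length-tokens {N = λ i → filterᵇ (adj (G x unset) i) (exposed alice)} {λ i → filterᵇ (adj (G unset unset) i) (exposed alice)}
        (All.map (λ {i} i∈ → trans (size-back x i)
        (trans (back-degree-constant x (decode i) i∈) (sym (size-back unset i)))) (exposed-layer alice′))))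
    (sym (List.length-++ (tokens (λ _ → []) (exposed alice)))))

  presents : ∀ x y → VAFrom (G x y) [] (aliceTokens x ++ bobTokens y)
  presents x y = subst (VAFrom (G x y) []) (sym split)
    (expose (G x y) (independent alice) [] (exposed alice) (exposed-layer alice) ↭-refl λ seen₁ →
     expose (G x y) (independent alice′) (exposed alice) (exposed alice′) (exposed-layer alice′)
       (↭-trans seen₁ (↭-reflexive (List.++-identityʳ (exposed alice)))) λ seen₂ →
     expose (G x y) (independent bob) (exposed alice′ ++ exposed alice) (exposed bob) (exposed-layer bob) seen₂ λ seen₃ →
     done (↭-trans seen₃ exposed-↭))
    where
    independent : ∀ ℓ i j → layer i ≡ ℓ → layer j ≡ ℓ → adj (G x y) i j ≡ false
    independent ℓ i j i∈ j∈ = adjacent-layer x y (decode i) (decode j) (trans i∈ (sym j∈))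

    nbrs : (base : List (Fin (#V m))) → Fin (#V m) → List (Fin (#V m))
    nbrs base i = filterᵇ (adj (G x y) i) base

    alice′-local : tokens (λ i → filterᵇ (adj (G x unset) i) (exposed alice)) (exposed alice′) ≡ tokens (nbrs (exposed alice)) (exposed alice′)
    alice′-local = tokens-cong (All.map (λ {i} i∈ →
      filterᵇ-cong {f = adj (G x unset) i} {adj (G x y) i} (All.map (λ {j} j∈ → adjacent-alice x y (decode i) (decode j) i∈ j∈) (exposed-layer alice)))
      (exposed-layer alice′))

    bob-local : bobTokens y ≡ tokens (nbrs (exposed alice′ ++ exposed alice)) (exposed bob)
    bob-local = tokens-cong (All.map (λ {i} i∈ →
      filterᵇ-cong {f = adj (G unset y) i} {adj (G x y) i} (All.universal
        (λ j → adjacent-bob x y (decode i) (decode j) i∈) (exposed alice′ ++ exposed alice))) (exposed-layer bob))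

    split : aliceTokens x ++ bobTokens y ≡
            tokens (nbrs []) (exposed alice) ++ tokens (nbrs (exposed alice)) (exposed alice′) ++
            tokens (nbrs (exposed alice′ ++ exposed alice)) (exposed bob) ++ []
    split = trans (List.++-assoc (tokens (λ _ → []) (exposed alice)) _ _)
      (cong (tokens (λ _ → []) (exposed alice) ++_) (cong₂ _++_ alice′-local (trans bob-local (sym (List.++-identityʳ _)))))

-- Entries beyond the end of the vector read as false.
entryAt : ∀ {m} → Vec Bool m → ℕ → Bool
entryAt []       _       = false
entryAt (b ∷ bs) zero    = b
entryAt (b ∷ bs) (suc j) = entryAt bs j

entryAt-end : ∀ {m} (bs : Vec Bool m) → entryAt bs m ≡ false
entryAt-end []       = refl
entryAt-end (b ∷ bs) = entryAt-end bs

-- Together with `entryAt-end` the leading `false` provides the boundary conditions `x₀` and `xₘ`.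
aliceInput : ∀ {m} → Vec Bool m → ℕ → Bool
aliceInput bs zero    = false
aliceInput bs (suc j) = entryAt bs j

-- `parity` recurses at the last period but `dot` at the first entry; this splits off the first
-- period instead.
parity-head : ∀ x y j l → parity x y (suc j) l ≡ (y 0 ∧ (l xor x 1)) xor parity (x ∘ suc) (y ∘ suc) j l
parity-head x y zero    l = sym (Bool.xor-identityʳ _)
parity-head x y (suc j) l = trans (cong (_xor (y (suc j) ∧ (l xor x (suc (suc j))))) (parity-head x y j l))
  (xor-assoc (y 0 ∧ (l xor x 1)) (parity (x ∘ suc) (y ∘ suc) j l) _)

-- For `l` false, period `j` contributes `y j ∧ x (suc j)`. The assumption concerns only positive
-- indices so that the induction can pass to `x ∘ suc`, which starts with an entry of `as`.
parity≡dot : ∀ {m} (as bs : Vec Bool m) x → (∀ j → x (suc j) ≡ entryAt as j) → parity x (entryAt bs) m false ≡ dot as bs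
parity≡dot []       []       x x≗as = refl
parity≡dot {suc m} (a ∷ as) (b ∷ bs) x x≗as = trans (parity-head x (entryAt (b ∷ bs)) m false)
  (cong₂ _xor_ (trans (cong (b ∧_) (x≗as 0)) (Bool.∧-comm b a)) (parity≡dot as bs (x ∘ suc) (x≗as ∘ suc)))

-- The strand graph has `24 * r + 12` vertices, and 50 exceeds 24: together the bounds give `50 * r`
-- ≤ `62 + 24 * r`, and 62 is less than `26 * 3`.
overlong : ∀ r q → r < 2 + q → 50 * q ≤ suc (r * 2) * 12 → r < 3
overlong r q r<2+q 50q≤n = ℕ.*-cancelˡ-< 26 r 3 (ℕ.+-cancelʳ-< (24 * r) (26 * r) (26 * 3) (begin-strict
  26 * r + 24 * r        ≡⟨ lemma₁ r ⟩
  50 * r                 ≤⟨ ℕ.*-monoʳ-≤ 50 (ℕ.s≤s⁻¹ r<2+q) ⟩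
  50 * (1 + q)           ≡⟨ lemma₂ q ⟩
  50 + 50 * q            ≤⟨ ℕ.+-monoʳ-≤ 50 50q≤n ⟩
  50 + suc (r * 2) * 12  ≡⟨ lemma₃ r ⟩
  62 + 24 * r            <⟨ ℕ.+-monoˡ-< (24 * r) (ℕ.m≤m+n 63 15) ⟩
  26 * 3 + 24 * r        ∎))
  where
  open ℕ.≤-Reasoning
  lemma₁ : ∀ r → 26 * r + 24 * r ≡ 50 * r
  lemma₁ = ℕ.solve-∀
  lemma₂ : ∀ q → 50 * (1 + q) ≡ 50 + 50 * q
  lemma₂ = ℕ.solve-∀
  lemma₃ : ∀ r → 50 + (1 + r * 2) * 12 ≡ 62 + 24 * r
  lemma₃ = ℕ.solve-∀

-- The reduction from the inner product

solved : ∀ {m p s} (A : Algorithm (VAToken (#V m)) p s) →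
  (∀ (G : Graph (Fin (#V m))) → Δ G ≤ 2 → ∀ σ → VAFrom G [] σ → SolvesInstance A σ (ClusterVertexDeletion G (4 * m))) →
  ∀ as bs → SolvesInstance A (aliceTokens {m} (aliceInput as) ++ bobTokens {m} (entryAt bs)) (dot {m} as bs ≡ true)
solved {m} A solves as bs = (λ odd → proj₁ both (deletable odd)) , (λ ¬odd → proj₂ both (¬deletable (Bool.¬-not ¬odd)))
  where
  x y : ℕ → Bool
  x = aliceInput as
  y = entryAt bs
  parity≡ : ∀ {b} → dot as bs ≡ b → parity x y m false ≡ b
  parity≡ = trans (parity≡dot as bs x (λ _ → refl))
  both : SolvesInstance A (aliceTokens {m} x ++ bobTokens {m} y) (ClusterVertexDeletion (strands m x y) (4 * m))
  both = solves (strands m x y) (Δ≤2 {m} x y refl (entryAt-end as)) (aliceTokens {m} x ++ bobTokens {m} y) (presents {m} x y)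
  deletable : dot as bs ≡ true → ClusterVertexDeletion (strands m x y) (4 * m)
  deletable odd = odd⇒deletable {m} x y refl (entryAt-end as) (parity≡ odd)
  ¬deletable : dot as bs ≡ false → ¬ ClusterVertexDeletion (strands m x y) (4 * m)
  ¬deletable even = even⇒¬deletable {m} x y refl (entryAt-end as) (parity≡ even)

solves⇒space : ∀ r {p s} (A : Algorithm (VAToken (#V (r * 2))) p s) →
  (∀ (G : Graph (Fin (#V (r * 2)))) → Δ G ≤ 2 → ∀ σ → VAFrom G [] σ → SolvesInstance A σ (ClusterVertexDeletion G (4 * (r * 2)))) →
  r < 2 + (s + s) * p
solves⇒space r A solves = streaming⇒space A r (aliceTokens {r * 2} ∘ aliceInput) (bobTokens {r * 2} ∘ entryAt)
  (length (aliceTokens {r * 2} unset)) (λ as → length-aliceTokens {r * 2} (aliceInput as)) (solved {r * 2} A solves)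

r≤#V : ∀ r → r ≤ #V (r * 2)
r≤#V r = ℕ.≤-trans (ℕ.m≤m*n r 2) (ℕ.≤-trans (ℕ.n≤1+n (r * 2)) (ℕ.m≤m*n (suc (r * 2)) 12))

bounded : ∀ r p {{_ : NonZero p}} s (A : Algorithm (VAToken (#V (r * 2))) p s) →
  + s / 1 ≤ℚ (+ 1 / 100) *ℚ (+ (#V (r * 2)) / p) →
  (∀ (G : Graph (Fin (#V (r * 2)))) → Δ G ≤ 2 → ∀ σ → VAFrom G [] σ → SolvesInstance A σ (ClusterVertexDeletion G (4 * (r * 2)))) →
  r < 3
bounded r p s A small solves = overlong r ((s + s) * p) (solves⇒space r A solves) (sublinear⇒small (#V (r * 2)) p s small)

hard : (p : ℕ) → {{_ : NonZero p}} → Hard VA (λ n k → + n / p) p (λ G → Δ G ≤ 2) ClusterVertexDeletion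
-- `3 + N` is large enough both for the bound from `s∈o` to apply and to contradict `r < 3`.
hard p (s , s∈o , A , solves) = ℕ.<⇒≱ (go (3 + N) (ℕ.m≤n+m N 3)) (ℕ.m≤m+n 3 N)
  where
  ε>0 = *<* (ℤ.+<+ (s≤s z≤n))
  N : ℕ
  N = proj₁ (s∈o (+ 1 / 100) ε>0)
  go : ∀ r → N ≤ r → r < 3
  go r N≤r = bounded r p (s (#V (r * 2)) (4 * (r * 2))) (A (#V (r * 2)) (4 * (r * 2)))
    (proj₂ (s∈o (+ 1 / 100) ε>0) (#V (r * 2)) (4 * (r * 2)) (ℕ.≤-trans N≤r (r≤#V r)))
    (solves (#V (r * 2)) (4 * (r * 2)))

theorem5p3 : ∃[ d ] ((p : ℕ) → {{_ : NonZero p}} →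
    Hard VA (λ n k → + n / p) p (λ G → Δ G ≤ d) ClusterVertexDeletion)
theorem5p3 = 2 , λ p → hard p
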